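{- If $G$ is a subcubic graph (a finite simple graph with maximum degree at most $3$), then $\operatorname{tlir}(G) \leq 2$.
   Context: A total coloring of $G$ assigns a color to every vertex and every edge of $G$. For a color $c$ and a vertex $v$, the total $c$-degree of $v$ is the number of edges of color $c$ incident to $v$, plus $1$ if $v$ itself has color $c$. A total coloring is a locally irregular total coloring (TLIR coloring) if for every edge $uv$, with $c$ the color of $uv$, the total $c$-degrees of $u$ and $v$ differ. $\operatorname{tlir}(G)$ is the minimum number of colors in a TLIR coloring of $G$. -}

module Defs where

open import Data.Nat using (ℕ; zero; suc; _+_; _≤_)
open import Data.Bool using (Bool; true; false; _∧_; if_then_else_)
open import Data.Fin using (Fin; zero; suc; _≟_)
open import Data.Product using (Σ; _×_)
open import Relation.Nullary using (¬_)
open import Relation.Nullary.Decidable using (⌊_⌋)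
open import Relation.Binary.PropositionalEquality using (_≡_)

count : {n : ℕ} → (Fin n → Bool) → ℕ
count {zero}  p = 0
count {suc n} p = (if p zero then 1 else 0) + count (λ i → p (suc i))

record SimpleGraph (n : ℕ) : Set where
  field
    adj    : Fin n → Fin n → Bool
    sym    : ∀ u v → adj u v ≡ adj v u
    irrefl : ∀ v → adj v v ≡ false
open SimpleGraph public

degree : {n : ℕ} → SimpleGraph n → Fin n → ℕ
degree G v = count (λ u → adj G v u)

Subcubic : {n : ℕ} → SimpleGraph n → Set
Subcubic {n} G = ∀ (v : Fin n) → degree G v ≤ 3

-- total coloring with colors Fin k; edge colors given by a function on pairs,
-- required to be symmetric on edges (values on non-edges are irrelevant)
record TotalColoring {n : ℕ} (G : SimpleGraph n) (k : ℕ) : Set where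
  field
    vcol     : Fin n → Fin k
    ecol     : Fin n → Fin n → Fin k
    ecol-sym : ∀ u v → adj G u v ≡ true → ecol u v ≡ ecol v u
open TotalColoring public

totalDeg : {n k : ℕ} {G : SimpleGraph n} → TotalColoring G k → Fin k → Fin n → ℕ
totalDeg {G = G} φ c v =
  count (λ u → adj G v u ∧ ⌊ ecol φ v u ≟ c ⌋)
  + (if ⌊ vcol φ v ≟ c ⌋ then 1 else 0)

IsTLIR : {n k : ℕ} {G : SimpleGraph n} → TotalColoring G k → Set
IsTLIR {n} {G = G} φ =
  ∀ (u v : Fin n) → adj G u v ≡ true →
    ¬ (totalDeg φ (ecol φ u v) u ≡ totalDeg φ (ecol φ u v) v)

tlir≤ : {n : ℕ} → SimpleGraph n → ℕ → Set
tlir≤ G k = Σ (TotalColoring G k) IsTLIR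

{-# OPTIONS --safe #-}
module Submission where

-- Call the colours red (true) and blue (false), and take a partition into two sides in which
-- no vertex has more neighbours on its own side than on the other.  In a subcubic graph
-- every vertex then has at most one neighbour on its own side, its mate.
--
-- Aim at even totals on one side and odd totals on the other: then the edges between the
-- sides are fine.  The vertex colour adjusts the parity of one colour, and parity of the other
-- follows when the degree is odd.  What remains are conditions modulo 2 on the number
-- of red edges to the other side: it must be even at a vertex of degree 2 without mate, and
-- its parity must differ at two mates of equal degree.  This is a T-join problem: it can
-- be solved everywhere except at one chosen root per component.
--
-- Choose the side of the root to be even.  A root of degree 2, with or without mate, can be
-- repaired locally: recolour the root, or recolour some of its edges together with their other
-- ends in such a way that the totals of these ends do not change.  In a component
-- without a better root all vertices are cubic with a mate, and counting the
-- edges between the sides shows that the number of pairs of mates is even, so that the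
-- condition at the root follows from the others.

open import Defs
open import Data.Nat using (ℕ)

open import Algebra.Bundles using (module CommutativeRing)
open import Axiom.UniquenessOfIdentityProofs using (module Decidable⇒UIP)
open import Data.Bool as Bool using (Bool; true; false; _∧_; not; _xor_; if_then_else_)
open import Data.Bool.Properties
  using (∧-comm; ∧-zeroʳ; ∧-identityʳ; ∧-distribˡ-xor; not-involutive; ¬-not;
         xor-comm; xor-same; xor-identityʳ; not-distribˡ-xor;
         xor-∧-commutativeRing)
open import Data.Empty using (⊥; ⊥-elim)
open import Data.Fin using (Fin; zero; suc; _≟_)
import Data.Fin.Properties as Fin
open import Data.List using (List; []; _∷_; cartesianProduct; allFin)
open import Data.List.Membership.Propositional using (_∈_)
open import Data.List.Membership.Propositional.Properties using (∈-allFin; ∈-cartesianProduct⁺)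
open import Data.List.Relation.Unary.Any using (here; there)
open import Data.Nat as ℕ using (zero; suc; _+_; _≤_; _<_; _<?_; z≤n; s≤s)
open import Data.Nat.Induction using (Acc; acc; <-wellFounded)
open import Data.Nat.Properties hiding (_≟_; _<?_)
open import Data.Product using (Σ; ∃; _×_; _,_; proj₁; proj₂)
open import Data.Sum using (_⊎_; inj₁; inj₂)
open import Function using (_∘_)
open import Relation.Binary.Construct.Closure.ReflexiveTransitive using (Star; ε; _◅_; _◅◅_; reverse)
open import Relation.Binary.Definitions using (tri<; tri≈; tri>)
open import Relation.Binary.PropositionalEquality
  using (_≡_; _≢_; refl; trans; cong; cong₂; subst; module ≡-Reasoning)
  renaming (sym to ≡-sym)
open import Relation.Nullary using (¬_; Dec; yes; no)
open import Relation.Nullary.Decidable using (⌊_⌋; _×-dec_)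
open import Algebra.Properties.CommutativeMonoid.Sum +-0-commutativeMonoid
  using (sum; sum-cong-≗; ∑-distrib-+; ∑-comm)
open import Algebra.Properties.CommutativeSemigroup +-commutativeSemigroup
  using () renaming (interchange to +-interchange)
open import Algebra.Properties.CommutativeSemigroup (CommutativeRing.+-commutativeSemigroup xor-∧-commutativeRing)
  using () renaming (interchange to xor-interchange)

-- Boolean predicates on finite sets and their counts

infix 4 _==_

_==_ : Bool → Bool → Bool
true  == b = b
false == b = not b

⟦_⟧ : Bool → ℕ
⟦ b ⟧ = if b then 1 else 0

==-refl : ∀ b → (b == b) ≡ true
==-refl true  = refl
==-refl false = refl

⟦⟧-partition : ∀ p q → ⟦ p ⟧ ≡ ⟦ p ∧ q ⟧ + ⟦ p ∧ not q ⟧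
⟦⟧-partition false q     = refl
⟦⟧-partition true  true  = refl
⟦⟧-partition true  false = refl

⟦⟧≤1 : ∀ b → ⟦ b ⟧ ≤ 1
⟦⟧≤1 true  = s≤s z≤n
⟦⟧≤1 false = z≤n

≟-refl : ∀ {n} (v : Fin n) → ⌊ v ≟ v ⌋ ≡ true
≟-refl v with v ≟ v
... | yes _ = refl
... | no ne = ⊥-elim (ne refl)

≟-false : ∀ {n} {v w : Fin n} → v ≢ w → ⌊ v ≟ w ⌋ ≡ false
≟-false {v = v} {w} ne with v ≟ w
... | yes e = ⊥-elim (ne e)
... | no _  = refl

true≢false : ∀ {b} → b ≡ true → b ≡ false → ∀ {A : Set} → A
true≢false refl ()

∧-true : ∀ {a b} → a ∧ b ≡ true → a ≡ true × b ≡ true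
∧-true {true} {true} _ = refl , refl

count≡sum : ∀ {n} (p : Fin n → Bool) → count p ≡ sum (⟦_⟧ ∘ p)
count≡sum {zero}  p = refl
count≡sum {suc n} p = cong (⟦ p zero ⟧ +_) (count≡sum (p ∘ suc))

module _ {n : ℕ} where

  count-cong : {p q : Fin n → Bool} → (∀ i → p i ≡ q i) → count p ≡ count q
  count-cong {p} {q} eq = begin
    count p             ≡⟨ count≡sum p ⟩
    sum (⟦_⟧ ∘ p)       ≡⟨ sum-cong-≗ (cong ⟦_⟧ ∘ eq) ⟩
    sum (⟦_⟧ ∘ q)       ≡⟨ count≡sum q ⟨
    count q             ∎
    where open ≡-Reasoning

  count-split : {p q r : Fin n → Bool} → (∀ i → ⟦ p i ⟧ ≡ ⟦ q i ⟧ + ⟦ r i ⟧) →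
                count p ≡ count q + count r
  count-split {p} {q} {r} eq = begin
    count p                             ≡⟨ count≡sum p ⟩
    sum (⟦_⟧ ∘ p)                       ≡⟨ sum-cong-≗ eq ⟩
    sum (λ i → ⟦ q i ⟧ + ⟦ r i ⟧)       ≡⟨ ∑-distrib-+ (⟦_⟧ ∘ q) (⟦_⟧ ∘ r) ⟩
    sum (⟦_⟧ ∘ q) + sum (⟦_⟧ ∘ r)       ≡⟨ cong₂ _+_ (count≡sum q) (count≡sum r) ⟨
    count q + count r                   ∎
    where open ≡-Reasoning

  count-partition : (p q : Fin n → Bool) →
                    count p ≡ count (λ i → p i ∧ q i) + count (λ i → p i ∧ not (q i))
  count-partition p q = count-split (λ i → ⟦⟧-partition (p i) (q i))

count-empty : ∀ {n} {p : Fin n → Bool} → (∀ i → p i ≡ false) → count p ≡ 0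
count-empty {zero}  e = refl
count-empty {suc n} e rewrite e zero = count-empty (e ∘ suc)

count≡0⇒false : ∀ {n} (p : Fin n → Bool) → count p ≡ 0 → ∀ i → p i ≡ false
count≡0⇒false p e zero with p zero
... | false = refl
count≡0⇒false p e (suc i) = count≡0⇒false (p ∘ suc) (m+n≡0⇒n≡0 ⟦ p zero ⟧ e) i

count-supported : ∀ {n} (p : Fin n → Bool) k → (∀ j → j ≢ k → p j ≡ false) → count p ≡ ⟦ p k ⟧
count-supported p zero e
  rewrite count-empty {p = p ∘ suc} (λ i → e (suc i) λ ()) = +-identityʳ ⟦ p zero ⟧
count-supported p (suc k) e
  rewrite e zero (λ ()) = count-supported (p ∘ suc) k (λ j j≢k → e (suc j) (j≢k ∘ Fin.suc-injective))

count-at : ∀ {n} (p : Fin n → Bool) k → count (λ i → p i ∧ ⌊ i ≟ k ⌋) ≡ ⟦ p k ⟧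
count-at p k = trans
  (count-supported (λ i → p i ∧ ⌊ i ≟ k ⌋) k (λ i ne → trans (cong (p i ∧_) (≟-false ne)) (∧-zeroʳ (p i))))
  (cong ⟦_⟧ (trans (cong (p k ∧_) (≟-refl k)) (∧-identityʳ (p k))))

module _ {n : ℕ} where

  -- Both sides are the common count away from `k` plus the two values at `k`. Written with sums, so
  -- that no subtraction of naturals occurs.
  count-update : (p q : Fin n → Bool) (k : Fin n) → (∀ i → i ≢ k → p i ≡ q i) →
                 count p + ⟦ q k ⟧ ≡ count q + ⟦ p k ⟧
  count-update p q k agree = begin
    count p + ⟦ q k ⟧                ≡⟨ cong (_+ ⟦ q k ⟧) (split p) ⟩
    ⟦ p k ⟧ + off p + ⟦ q k ⟧        ≡⟨ cong (λ m → ⟦ p k ⟧ + m + ⟦ q k ⟧) off≡ ⟩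
    ⟦ p k ⟧ + off q + ⟦ q k ⟧        ≡⟨ +-comm _ ⟦ q k ⟧ ⟩
    ⟦ q k ⟧ + (⟦ p k ⟧ + off q)      ≡⟨ cong (⟦ q k ⟧ +_) (+-comm ⟦ p k ⟧ _) ⟩
    ⟦ q k ⟧ + (off q + ⟦ p k ⟧)      ≡⟨ +-assoc ⟦ q k ⟧ _ _ ⟨
    ⟦ q k ⟧ + off q + ⟦ p k ⟧        ≡⟨ cong (_+ ⟦ p k ⟧) (split q) ⟨
    count q + ⟦ p k ⟧                ∎
    where
    open ≡-Reasoning
    off : (Fin n → Bool) → ℕ
    off r = count (λ i → r i ∧ not ⌊ i ≟ k ⌋)
    split : (r : Fin n → Bool) → count r ≡ ⟦ r k ⟧ + off r
    split r = trans (count-partition r (λ i → ⌊ i ≟ k ⌋)) (cong (_+ off r) (count-at r k))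
    off≡ : off p ≡ off q
    off≡ = count-cong same-off
      where
      same-off : ∀ i → p i ∧ not ⌊ i ≟ k ⌋ ≡ q i ∧ not ⌊ i ≟ k ⌋
      same-off i with i ≟ k
      ... | no ne = cong (_∧ true) (agree i ne)
      ... | yes _ with p i | q i
      ...   | true  | true  = refl
      ...   | true  | false = refl
      ...   | false | true  = refl
      ...   | false | false = refl

count>0 : ∀ {n} (p : Fin n → Bool) k → p k ≡ true → 1 ≤ count p
count>0 p zero    e rewrite e = s≤s z≤n
count>0 p (suc k) e = ≤-trans (count>0 (p ∘ suc) k e) (m≤n+m _ ⟦ p zero ⟧)

count-witness : ∀ {n} (p : Fin n → Bool) → 1 ≤ count p → ∃ λ k → p k ≡ true
count-witness {suc n} p le with p zero in eq
... | true  = zero , eq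
... | false with count-witness (p ∘ suc) le
...   | k , e = suc k , e

count≡1⇒unique : ∀ {n} (p : Fin n → Bool) → count p ≡ 1 →
                 ∀ {i j} → p i ≡ true → p j ≡ true → i ≡ j
count≡1⇒unique {suc n} p one {zero} {zero} _ _ = refl
count≡1⇒unique {suc n} p one {zero} {suc j} pi pj rewrite pi =
  true≢false pj (count≡0⇒false (p ∘ suc) (suc-injective one) j)
count≡1⇒unique {suc n} p one {suc i} {zero} pi pj rewrite pj =
  true≢false pi (count≡0⇒false (p ∘ suc) (suc-injective one) i)
count≡1⇒unique {suc n} p one {suc i} {suc j} pi pj with p zero
... | true  = true≢false pi (count≡0⇒false (p ∘ suc) (suc-injective one) i)
... | false = cong suc (count≡1⇒unique (p ∘ suc) one pi pj)

-- Parity and double counting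

odd : ℕ → Bool
odd zero    = false
odd (suc n) = not (odd n)

odd-+ : ∀ m n → odd (m + n) ≡ odd m xor odd n
odd-+ zero    n = refl
odd-+ (suc m) n = trans (cong not (odd-+ m n)) (not-distribˡ-xor (odd m) (odd n))

odd-⟦⟧ : ∀ b → odd ⟦ b ⟧ ≡ b
odd-⟦⟧ true  = refl
odd-⟦⟧ false = refl

odd-double : ∀ m → odd (m + m) ≡ false
odd-double m = trans (odd-+ m m) (xor-same (odd m))

-- Parity is a homomorphism to the field with two elements, where `xor` is addition: a point lying
-- in both sets is lost twice.
odd-count-xor : ∀ {n} (p q : Fin n → Bool) →
                odd (count (λ i → p i xor q i)) ≡ odd (count p) xor odd (count q)
odd-count-xor {zero}  p q = refl
odd-count-xor {suc n} p q = begin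
  odd (⟦ p₀ xor q₀ ⟧ + count (λ i → p (suc i) xor q (suc i)))
    ≡⟨ odd-+ ⟦ p₀ xor q₀ ⟧ _ ⟩
  odd ⟦ p₀ xor q₀ ⟧ xor odd (count (λ i → p (suc i) xor q (suc i)))
    ≡⟨ cong₂ _xor_ (odd-⟦⟧ (p₀ xor q₀)) (odd-count-xor (p ∘ suc) (q ∘ suc)) ⟩
  (p₀ xor q₀) xor (P xor Q)   ≡⟨ xor-interchange p₀ q₀ P Q ⟩
  (p₀ xor P) xor (q₀ xor Q)
    ≡⟨ cong₂ _xor_ (head-tail p) (head-tail q) ⟨
  odd (count p) xor odd (count q) ∎
  where
  open ≡-Reasoning
  p₀ = p zero
  q₀ = q zero
  P = odd (count (p ∘ suc))
  Q = odd (count (q ∘ suc))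
  head-tail : (r : Fin (suc n) → Bool) → odd (count r) ≡ r zero xor odd (count (r ∘ suc))
  head-tail r = trans (odd-+ ⟦ r zero ⟧ _) (cong (_xor odd (count (r ∘ suc))) (odd-⟦⟧ (r zero)))

-- The pairs are ordered, so under a symmetric predicate an edge contributes twice.
pairs : ∀ {n} → (Fin n → Fin n → Bool) → ℕ
pairs p = sum (λ v → count (p v))

module _ {n : ℕ} where

  pairs-cong : {p q : Fin n → Fin n → Bool} → (∀ v w → p v w ≡ q v w) → pairs p ≡ pairs q
  pairs-cong eq = sum-cong-≗ (λ v → count-cong (eq v))

  pairs-flip : (p : Fin n → Fin n → Bool) → pairs p ≡ pairs (λ v w → p w v)
  pairs-flip p = begin
    sum (λ v → count (p v))                     ≡⟨ sum-cong-≗ (λ v → count≡sum (p v)) ⟩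
    sum (λ v → sum (λ w → ⟦ p v w ⟧))           ≡⟨ ∑-comm (λ v w → ⟦ p v w ⟧) ⟩
    sum (λ w → sum (λ v → ⟦ p v w ⟧))           ≡⟨ sum-cong-≗ (λ w → count≡sum (λ v → p v w)) ⟨
    sum (λ w → count (λ v → p v w))             ∎
    where open ≡-Reasoning

  pairs-split : {p q r : Fin n → Fin n → Bool} → (∀ v w → ⟦ p v w ⟧ ≡ ⟦ q v w ⟧ + ⟦ r v w ⟧) →
                pairs p ≡ pairs q + pairs r
  pairs-split {p} {q} {r} eq =
    trans (sum-cong-≗ (λ v → count-split (eq v))) (∑-distrib-+ (λ v → count (q v)) (λ v → count (r v)))

-- Repairing a colouring at the roots of the components

module _ {n : ℕ} (G : SimpleGraph n) where

  nbrs : (Fin n → Fin n → Bool) → Fin n → ℕ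
  nbrs p v = count (λ w → adj G v w ∧ p v w)

  adj-sym : ∀ {v w} → adj G v w ≡ true → adj G w v ≡ true
  adj-sym {v} {w} e = trans (SimpleGraph.sym G w v) e

  adj-irrefl : ∀ {v w} → adj G v w ≡ true → v ≢ w
  adj-irrefl {v} e refl = true≢false e (irrefl G v)

  total : (ec : Fin n → Fin n → Bool) (vc : Fin n → Bool) → Bool → Fin n → ℕ
  total ec vc c v = nbrs (λ v w → ec v w == c) v + ⟦ vc v == c ⟧

  colour : Bool → Fin 2
  colour true  = zero
  colour false = suc zero

  colour-≟ : ∀ b c → ⌊ colour b ≟ colour c ⌋ ≡ (b == c)
  colour-≟ true  true  = refl
  colour-≟ true  false = refl
  colour-≟ false true  = refl
  colour-≟ false false = refl

  boolean-colouring : (ec : Fin n → Fin n → Bool) (vc : Fin n → Bool) →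
    (∀ {u v} → adj G u v ≡ true → ec u v ≡ ec v u) →
    (∀ {u v} → adj G u v ≡ true → total ec vc (ec u v) u ≢ total ec vc (ec u v) v) →
    tlir≤ G 2
  boolean-colouring ec vc ec-sym differ = φ , tlir
    where
    φ : TotalColoring G 2
    φ = record { vcol = colour ∘ vc ; ecol = λ u v → colour (ec u v) ; ecol-sym = λ u v e → cong colour (ec-sym e) }
    totalDeg≡ : ∀ c v → totalDeg φ (colour c) v ≡ total ec vc c v
    totalDeg≡ c v = cong₂ _+_
      (count-cong (λ w → cong (adj G v w ∧_) (colour-≟ (ec v w) c)))
      (cong ⟦_⟧ (colour-≟ (vc v) c))
    tlir : IsTLIR φ
    tlir u v e eq = differ e (trans (≡-sym (totalDeg≡ (ec u v) u)) (trans eq (totalDeg≡ (ec u v) v)))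

  module Repairs (ec : Fin n → Fin n → Bool) (vc : Fin n → Bool)
    (ec-sym : ∀ {u v} → adj G u v ≡ true → ec u v ≡ ec v u)
    (root : Fin n → Fin n)
    (root-edge : ∀ {u v} → adj G u v ≡ true → root u ≡ root v)
    where

    -- Recolouring the edges from r to S and, at the same time, the vertices of S
    -- leaves all total degrees on S unchanged.
    record Repair (r : Fin n) : Set where
      field
        flip   : Bool
        S      : Fin n → Bool
        S-nbr  : ∀ {z} → S z ≡ true → adj G r z ≡ true × vc z ≡ not (ec r z)
        differ : ∀ {z} → adj G r z ≡ true → let c = ec r z xor S z in
          count (λ w → adj G r w ∧ ((ec r w xor S w) == c)) + ⟦ vc r xor flip == c ⟧
            ≢ total ec vc c z
    open Repair

    -- Before the repairs only edges with a root as an end may fail. Adjacent vertices share their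
    -- root, so two roots are never adjacent, and repairs at different roots take place in different
    -- components.
    module Apply (ok : ∀ {u v} → adj G u v ≡ true → root u ≢ u → root v ≢ v →
                       total ec vc (ec u v) u ≢ total ec vc (ec u v) v)
                 (repair : ∀ r → root r ≡ r → Repair r) where

      recoloured : Fin n → Fin n → Bool
      recoloured u w with root u ≟ u
      ... | yes e = S (repair u e) w
      ... | no  _ = false

      flipped : Fin n → Bool
      flipped v with root v ≟ v
      ... | yes e = flip (repair v e)
      ... | no  _ = false

      recoloured-root : ∀ {u w} → recoloured u w ≡ true → root u ≡ u × adj G u w ≡ true × vc w ≡ not (ec u w)
      recoloured-root {u} {w} e with root u ≟ u
      ... | yes r = r , S-nbr (repair u r) e
      recoloured-root {u} () | no _

      nonroot-recoloured : ∀ {u w} → root u ≢ u → recoloured u w ≡ false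
      nonroot-recoloured {u} nr with root u ≟ u
      ... | yes r = ⊥-elim (nr r)
      ... | no _  = refl

      other-recoloured : ∀ {u w} → u ≢ root w → recoloured u w ≡ false
      other-recoloured {u} {w} ne with recoloured u w in eq
      ... | false = refl
      ... | true with recoloured-root eq
      ...   | r , a , _ = ⊥-elim (ne (trans (≡-sym r) (root-edge a)))

      self-recoloured : ∀ v → recoloured v v ≡ false
      self-recoloured v with recoloured v v in eq
      ... | false = refl
      ... | true  = ⊥-elim (adj-irrefl (proj₁ (proj₂ (recoloured-root eq))) refl)

      -- `recoloured` is directed away from the root; adding the reversed pair makes the new colour
      -- symmetric. No edge is toggled twice, since at most one of its ends is a root.
      ec′ : Fin n → Fin n → Bool
      ec′ u w = ec u w xor (recoloured u w xor recoloured w u)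

      vc′ : Fin n → Bool
      vc′ v = vc v xor (flipped v xor recoloured (root v) v)

      ec′-sym : ∀ {u v} → adj G u v ≡ true → ec′ u v ≡ ec′ v u
      ec′-sym {u} {v} e = cong₂ _xor_ (ec-sym e) (xor-comm (recoloured u v) (recoloured v u))

      -- The only edge at `v` that can change is the one to its root `k`. When it changes, so does
      -- the colour of `v`; by `S-nbr` these two colours were opposite, so edge and vertex merely
      -- exchange colours and each total keeps its value.
      nonroot-total : ∀ {v} → root v ≢ v → ∀ c → total ec′ vc′ c v ≡ total ec vc c v
      nonroot-total {v} nr c = main (recoloured k v) refl
        where
        open ≡-Reasoning
        k = root v
        p q : Fin n → Bool
        p w = adj G v w ∧ (ec v w == c)
        q w = adj G v w ∧ ((ec v w xor recoloured w v) == c)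
        flipped≡ : flipped v ≡ false
        flipped≡ with root v ≟ v
        ... | yes e = ⊥-elim (nr e)
        ... | no _  = refl
        total′ : total ec′ vc′ c v ≡ count q + ⟦ vc v xor recoloured k v == c ⟧
        total′ = cong₂ _+_
          (count-cong λ w → cong (λ b → adj G v w ∧ ((ec v w xor (b xor recoloured w v)) == c)) (nonroot-recoloured nr))
          (cong (λ b → ⟦ vc v xor (b xor recoloured k v) == c ⟧) flipped≡)
        agree : ∀ w → w ≢ k → p w ≡ q w
        agree w ne rewrite other-recoloured {w} {v} ne | xor-identityʳ (ec v w) = refl
        exchange : ∀ a e b → b ≡ not e → ∀ s s′ → s + ⟦ (e xor true) == c ⟧ ≡ s′ + ⟦ e == c ⟧ →
                   s′ + ⟦ (b xor true) == c ⟧ ≡ s + ⟦ b == c ⟧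
        exchange a true  b refl s s′ eq = ≡-sym eq
        exchange a false b refl s s′ eq = ≡-sym eq
        main : ∀ b → recoloured k v ≡ b → total ec′ vc′ c v ≡ total ec vc c v
        main false e = trans total′ (cong₂ _+_
          (count-cong λ w → q≡p w)
          (trans (cong (λ b → ⟦ vc v xor b == c ⟧) e) (cong (λ b → ⟦ b == c ⟧) (xor-identityʳ (vc v)))))
          where
          q≡p : ∀ w → q w ≡ p w
          q≡p w with w ≟ k
          ... | no ne = ≡-sym (agree w ne)
          ... | yes refl rewrite e | xor-identityʳ (ec v k) = refl
        main true e with recoloured-root e
        ... | _ , a , vc≡ = trans total′ (trans (cong (λ b → count q + ⟦ vc v xor b == c ⟧) e)
              (exchange true (ec v k) (vc v) (trans vc≡ (cong not (ec-sym a))) (count p) (count q) upd))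
          where
          upd : count p + ⟦ (ec v k xor true) == c ⟧ ≡ count q + ⟦ ec v k == c ⟧
          upd = begin
            count p + ⟦ (ec v k xor true) == c ⟧  ≡⟨ cong (λ b → count p + ⟦ b ⟧) qk ⟨
            count p + ⟦ q k ⟧                     ≡⟨ count-update p q k agree ⟩
            count q + ⟦ p k ⟧                     ≡⟨ cong (λ b → count q + ⟦ b ⟧) pk ⟩
            count q + ⟦ ec v k == c ⟧             ∎
            where
            qk : q k ≡ ((ec v k xor true) == c)
            qk rewrite adj-sym a | e = refl
            pk : p k ≡ (ec v k == c)
            pk rewrite adj-sym a = refl

      module _ {r} (e : root r ≡ r) where
        private R = repair r e

        -- The repair was chosen from a proof of `root r ≡ r`. Such proofs are unique, so the repair
        -- found by the case distinction is `R`.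
        recoloured-at-root : ∀ w → recoloured r w ≡ S R w
        recoloured-at-root w with root r ≟ r
        ... | yes e′ = cong (λ x → S (repair r x) w) (Decidable⇒UIP.≡-irrelevant _≟_ e′ e)
        ... | no ne  = ⊥-elim (ne e)

        flipped-at-root : flipped r ≡ flip R
        flipped-at-root with root r ≟ r
        ... | yes e′ = cong (λ x → flip (repair r x)) (Decidable⇒UIP.≡-irrelevant _≟_ e′ e)
        ... | no ne  = ⊥-elim (ne e)

        into-root : ∀ w → recoloured w r ≡ false
        into-root w with w ≟ r
        ... | yes refl = self-recoloured w
        ... | no ne    = other-recoloured (λ x → ne (trans x e))

        root-ec : ∀ w → ec′ r w ≡ ec r w xor S R w
        root-ec w rewrite recoloured-at-root w | into-root w = cong (ec r w xor_) (xor-identityʳ (S R w))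

        root-vc : vc′ r ≡ vc r xor flip R
        root-vc rewrite flipped-at-root | into-root (root r) = cong (vc r xor_) (xor-identityʳ (flip R))

        -- The neighbour `z` is not a root, so its new total equals the old one, which is the number
        -- that the field `differ` compares with.
        root-differ : ∀ {z} → adj G r z ≡ true → total ec′ vc′ (ec′ r z) r ≢ total ec′ vc′ (ec′ r z) z
        root-differ {z} a eq rewrite root-ec z = differ R a
          (trans (≡-sym (cong₂ _+_ (count-cong λ w → cong (λ b → adj G r w ∧ (b == c)) (root-ec w))
                         (cong (λ b → ⟦ b == c ⟧) root-vc)))
            (trans eq (nonroot-total (λ z-root → adj-irrefl a (trans (≡-sym e) (trans (root-edge a) z-root))) c)))
          where c = ec r z xor S R z

      tlir : tlir≤ G 2
      tlir = boolean-colouring ec′ vc′ ec′-sym edge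
        where
        edge : ∀ {u v} → adj G u v ≡ true → total ec′ vc′ (ec′ u v) u ≢ total ec′ vc′ (ec′ u v) v
        edge {u} {v} a eq = cases (root u ≟ u) (root v ≟ v)
          where
          same : root u ≢ u → root v ≢ v → ec′ u v ≡ ec u v
          same nu nv rewrite nonroot-recoloured {u} {v} nu | nonroot-recoloured {v} {u} nv = xor-identityʳ (ec u v)
          cases : Dec (root u ≡ u) → Dec (root v ≡ v) → ⊥
          cases (yes e) _ = root-differ e a eq
          cases (no _) (yes e) = root-differ e (adj-sym a)
            (subst (λ c → total ec′ vc′ c v ≡ total ec′ vc′ c u) (ec′-sym a) (≡-sym eq))
          cases (no nu) (no nv) = ok a nu nv
            (trans (≡-sym (nonroot-total nu (ec u v)))
              (trans (subst (λ c → total ec′ vc′ c u ≡ total ec′ vc′ c v) (same nu nv) eq)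
                (nonroot-total nv (ec u v))))

-- Spanning forests and T-joins

module _ {n : ℕ} (G : SimpleGraph n) where

  Adj : Fin n → Fin n → Set
  Adj v w = adj G v w ≡ true

  -- Encoded as in union-find: a representative for each vertex and a walk in `G` leading to it.
  -- `root-max` makes the representative a vertex of largest priority in its class.
  record Forest (prio : Fin n → ℕ) (es : List (Fin n × Fin n)) : Set where
    field
      root      : Fin n → Fin n
      root-idem : ∀ v → root (root v) ≡ root v
      root-edge : ∀ {u v} → (u , v) ∈ es → adj G u v ≡ true → root u ≡ root v
      root-max  : ∀ v → prio v ≤ prio (root v)
      path      : ∀ v → Star Adj v (root v)

  module _ {prio : Fin n → ℕ} where
    open Forest

    -- The class of `u` is redirected to the root of `v`; the inequality keeps `root-max`. The walk
    -- for the old root of `u` goes back to `u`, over the new edge, and on to the root of `v`.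
    merge : ∀ {es u v} (F : Forest prio es) → adj G u v ≡ true → root F u ≢ root F v →
            prio (root F u) ≤ prio (root F v) →
            Σ (Forest prio es) λ F′ → root F′ u ≡ root F′ v
    merge {es} {u} {v} F a ne le = record
      { root = new
      ; root-idem = new-idem
      ; root-edge = λ e a′ → cong redirect (root-edge F e a′)
      ; root-max = λ w → ≤-trans (root-max F w) (redirect-max (root F w))
      ; path = λ w → path F w ◅◅ redirect-path (root F w)
      } , joined
      where
      redirect : Fin n → Fin n
      redirect r with r ≟ root F u
      ... | yes _ = root F v
      ... | no _  = r
      new : Fin n → Fin n
      new w = redirect (root F w)
      redirect-other : ∀ {r} → r ≢ root F u → redirect r ≡ r
      redirect-other {r} ne′ with r ≟ root F u
      ... | yes e = ⊥-elim (ne′ e)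
      ... | no _  = refl
      redirect-v : redirect (root F v) ≡ root F v
      redirect-v = redirect-other (ne ∘ ≡-sym)
      new-idem : ∀ w → new (new w) ≡ new w
      new-idem w with root F w ≟ root F u
      ... | yes _ rewrite root-idem F v = redirect-v
      ... | no ne′ rewrite root-idem F w = redirect-other ne′
      redirect-max : ∀ r → prio r ≤ prio (redirect r)
      redirect-max r with r ≟ root F u
      ... | yes refl = le
      ... | no _     = ≤-refl
      redirect-path : ∀ r → Star Adj r (redirect r)
      redirect-path r with r ≟ root F u
      ... | yes refl = reverse (adj-sym G) (path F u) ◅◅ (a ◅ path F v)
      ... | no _     = ε
      joined : redirect (root F u) ≡ redirect (root F v)
      joined rewrite redirect-v with root F u ≟ root F u
      ... | yes _  = refl
      ... | no ne′ = ⊥-elim (ne′ refl)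

    join : ∀ {es} u v (F : Forest prio es) → adj G u v ≡ true →
           Σ (Forest prio es) λ F′ → root F′ u ≡ root F′ v
    join u v F a with root F u ≟ root F v
    ... | yes e = F , e
    ... | no ne with ≤-total (prio (root F u)) (prio (root F v))
    ...   | inj₁ le = merge F a ne le
    ...   | inj₂ ge with merge F (adj-sym G a) (ne ∘ ≡-sym) ge
    ...     | F′ , e = F′ , ≡-sym e

    forest : ∀ es → Forest prio es
    forest [] = record
      { root = λ v → v ; root-idem = λ _ → refl ; root-edge = λ () ; root-max = λ _ → ≤-refl ; path = λ _ → ε }
    forest ((u , v) ∷ es) with adj G u v in a
    ... | false = record
      { root = root F ; root-idem = root-idem F ; root-max = root-max F ; path = path F
      ; root-edge = λ { (here refl) a′ → true≢false a′ a ; (there e) → root-edge F e } }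
      where F = forest es
    ... | true with join u v (forest es) a
    ...   | F , e = record
      { root = root F ; root-idem = root-idem F ; root-max = root-max F ; path = path F
      ; root-edge = λ { (here refl) _ → e ; (there e′) → root-edge F e′ } }

  spanning-forest : (prio : Fin n → ℕ) → Σ (Forest prio (cartesianProduct (allFin n) (allFin n))) λ F →
    ∀ {u v} → adj G u v ≡ true → Forest.root F u ≡ Forest.root F v
  spanning-forest prio = F , Forest.root-edge F (∈-cartesianProduct⁺ (∈-allFin _) (∈-allFin _))
    where F = forest (cartesianProduct (allFin n) (allFin n))

  -- The boundary of the edge set `χ` as a chain modulo 2.
  boundary : (Fin n → Fin n → Bool) → Fin n → Bool
  boundary χ v = odd (nbrs G χ v)

  boundary-xor : ∀ χ ψ v → boundary (λ v w → χ v w xor ψ v w) v ≡ boundary χ v xor boundary ψ v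
  boundary-xor χ ψ v = trans
    (cong odd (count-cong λ w → ∧-distribˡ-xor (adj G v w) (χ v w) (ψ v w)))
    (odd-count-xor (λ w → adj G v w ∧ χ v w) (λ w → adj G v w ∧ ψ v w))

  single-edge : Fin n → Fin n → Fin n → Fin n → Bool
  single-edge u v x y = (⌊ x ≟ u ⌋ ∧ ⌊ y ≟ v ⌋) xor (⌊ x ≟ v ⌋ ∧ ⌊ y ≟ u ⌋)

  single-edge-boundary : ∀ {u v} → adj G u v ≡ true → ∀ x →
    boundary (single-edge u v) x ≡ ⌊ x ≟ u ⌋ xor ⌊ x ≟ v ⌋
  single-edge-boundary {u} {v} a x = trans
    (boundary-xor (λ x y → ⌊ x ≟ u ⌋ ∧ ⌊ y ≟ v ⌋) (λ x y → ⌊ x ≟ v ⌋ ∧ ⌊ y ≟ u ⌋) x)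
    (cong₂ _xor_ (half a) (half (adj-sym G a)))
    where
    half : ∀ {u v} → adj G u v ≡ true → boundary (λ x y → ⌊ x ≟ u ⌋ ∧ ⌊ y ≟ v ⌋) x ≡ ⌊ x ≟ u ⌋
    half {u} {v} a with x ≟ u
    ... | no _ = cong odd (count-empty λ y → ∧-zeroʳ (adj G x y))
    ... | yes refl = cong odd (trans (count-supported (λ y → adj G x y ∧ ⌊ y ≟ v ⌋) v off) (cong ⟦_⟧ on))
      where
      off : ∀ y → y ≢ v → adj G x y ∧ ⌊ y ≟ v ⌋ ≡ false
      off y ne rewrite ≟-false ne with adj G x y
      ... | true = refl
      ... | false = refl
      on : adj G x v ∧ ⌊ v ≟ v ⌋ ≡ true
      on rewrite a = ≟-refl v

  Symmetric : (Fin n → Fin n → Bool) → Set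
  Symmetric χ = ∀ u v → χ u v ≡ χ v u

  -- `χ` consists of the edges that the walk uses an odd number of times. The boundaries of the
  -- single steps telescope, so only the two ends of the walk remain.
  path-edges : ∀ {u v} → Star Adj u v → Σ (Fin n → Fin n → Bool) λ χ →
    Symmetric χ × (∀ x → boundary χ x ≡ ⌊ x ≟ u ⌋ xor ⌊ x ≟ v ⌋)
  path-edges {u} ε = (λ _ _ → false) , (λ _ _ → refl) , λ x → trans
    (cong odd (count-empty λ w → ∧-zeroʳ (adj G x w))) (≡-sym (xor-same ⌊ x ≟ u ⌋))
  path-edges {u} {w} (_◅_ {j = v} a p) with path-edges p
  ... | χ , χ-sym , ∂χ =
    (λ x y → single-edge u v x y xor χ x y) ,
    (λ x y → cong₂ _xor_ (single-sym x y) (χ-sym x y)) ,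
    λ x → trans (boundary-xor (single-edge u v) χ x)
      (trans (cong₂ _xor_ (single-edge-boundary a x) (∂χ x)) (telescope ⌊ x ≟ u ⌋ ⌊ x ≟ v ⌋ ⌊ x ≟ w ⌋))
    where
    swap : ∀ a b c d → (a ∧ b) xor (c ∧ d) ≡ (d ∧ c) xor (b ∧ a)
    swap true  true  c d = trans (xor-comm true (c ∧ d)) (cong (_xor true) (∧-comm c d))
    swap true  false c d = trans (∧-comm c d) (≡-sym (xor-identityʳ (d ∧ c)))
    swap false true  c d = trans (∧-comm c d) (≡-sym (xor-identityʳ (d ∧ c)))
    swap false false c d = trans (∧-comm c d) (≡-sym (xor-identityʳ (d ∧ c)))
    single-sym : Symmetric (single-edge u v)
    single-sym x y = swap ⌊ x ≟ u ⌋ ⌊ y ≟ v ⌋ ⌊ x ≟ v ⌋ ⌊ y ≟ u ⌋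
    telescope : ∀ a b c → (a xor b) xor (b xor c) ≡ a xor c
    telescope true  true  c = refl
    telescope true  false c = refl
    telescope false true  true  = refl
    telescope false true  false = refl
    telescope false false c = refl

  module _ {root : Fin n → Fin n} (root-idem : ∀ v → root (root v) ≡ root v)
           (path : ∀ v → Star Adj v (root v)) (demand : Fin n → Bool) where

    -- A vertex with the wrong parity is corrected by adding the walk to its root. This changes
    -- parities only at that vertex and at the root, so the vertices treated before stay correct
    -- unless they are roots.
    join-list : (vs : List (Fin n)) → Σ (Fin n → Fin n → Bool) λ χ →
      Symmetric χ × (∀ {v} → v ∈ vs → root v ≢ v → boundary χ v ≡ demand v)
    join-list [] = (λ _ _ → false) , (λ _ _ → refl) , λ ()
    join-list (x ∷ vs) with join-list vs
    ... | χ , χ-sym , met with boundary χ x Bool.≟ demand x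
    ...   | yes e = χ , χ-sym , λ { (here refl) _ → e ; (there v∈) nr → met v∈ nr }
    ...   | no ne with path-edges (path x)
    ...     | ψ , ψ-sym , ∂ψ = (λ v w → χ v w xor ψ v w) , (λ v w → cong₂ _xor_ (χ-sym v w) (ψ-sym v w)) , met′
      where
      away : ∀ {v} → root v ≢ v → ⌊ v ≟ root x ⌋ ≡ false
      away nr = ≟-false λ { refl → nr (root-idem x) }
      toggled : ∀ {a b} → a ≢ b → a xor true ≡ b
      toggled {true}  {true}  ne = ⊥-elim (ne refl)
      toggled {true}  {false} ne = refl
      toggled {false} {true}  ne = refl
      toggled {false} {false} ne = ⊥-elim (ne refl)
      at-x : root x ≢ x → boundary (λ v w → χ v w xor ψ v w) x ≡ demand x
      at-x nr = trans (boundary-xor χ ψ x) (trans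
        (cong (boundary χ x xor_) (trans (∂ψ x) (cong₂ _xor_ (≟-refl x) (away nr)))) (toggled ne))
      met′ : ∀ {v} → v ∈ x ∷ vs → root v ≢ v → boundary (λ v w → χ v w xor ψ v w) v ≡ demand v
      met′ (here refl) nr = at-x nr
      met′ {v} (there v∈) nr with v ≟ x
      ... | yes refl = at-x nr
      ... | no v≢x = trans (boundary-xor χ ψ v) (trans
        (cong (boundary χ v xor_) (trans (∂ψ v) (cong₂ _xor_ (≟-false v≢x) (away nr))))
        (trans (xor-identityʳ (boundary χ v)) (met v∈ nr)))

    demand-join : Σ (Fin n → Fin n → Bool) λ χ →
      Symmetric χ × (∀ {v} → root v ≢ v → boundary χ v ≡ demand v)
    demand-join with join-list (allFin n)
    ... | χ , χ-sym , met = χ , χ-sym , met (∈-allFin _)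

-- Unfriendly partitions

pairs-row : ∀ {n} (p : Fin n → Fin n → Bool) k → pairs (λ v w → p v w ∧ ⌊ v ≟ k ⌋) ≡ count (p k)
pairs-row {n} p k = begin
  pairs (λ v w → p v w ∧ ⌊ v ≟ k ⌋)  ≡⟨ pairs-flip (λ v w → p v w ∧ ⌊ v ≟ k ⌋) ⟩
  pairs (λ w v → p v w ∧ ⌊ v ≟ k ⌋)  ≡⟨ sum-cong-≗ (λ w → count-at (λ v → p v w) k) ⟩
  sum (λ w → ⟦ p k w ⟧)              ≡⟨ count≡sum (p k) ⟨
  count (p k)                        ∎
  where open ≡-Reasoning

module _ {n : ℕ} (G : SimpleGraph n) where

  inner outer : (Fin n → Bool) → Fin n → ℕ
  inner σ = nbrs G (λ v w → σ v == σ w)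
  outer σ = nbrs G (λ v w → not (σ v == σ w))

  private
    away : Fin n → Fin n → Fin n → Bool
    away k v w = not ⌊ v ≟ k ⌋ ∧ not ⌊ w ≟ k ⌋

    monochromatic : (Fin n → Bool) → Fin n → Fin n → Bool
    monochromatic σ v w = adj G v w ∧ (σ v == σ w)

    ==-comm : ∀ a b → (a == b) ≡ (b == a)
    ==-comm true  true  = refl
    ==-comm true  false = refl
    ==-comm false true  = refl
    ==-comm false false = refl

  -- The pairs containing `k` are separated by position. There are no loops, so no pair has `k` in
  -- both places, and each position contributes `inner σ k`. The rest does not depend on the side of
  -- `k`.
  pairs-touching : ∀ σ k → pairs (monochromatic σ) ≡
    (inner σ k + inner σ k) + pairs (λ v w → monochromatic σ v w ∧ away k v w)
  pairs-touching σ k = begin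
    pairs m
      ≡⟨ pairs-split (λ v w → ⟦⟧-partition (m v w) ⌊ v ≟ k ⌋) ⟩
    pairs (λ v w → m v w ∧ ⌊ v ≟ k ⌋) + pairs (λ v w → m v w ∧ not ⌊ v ≟ k ⌋)
      ≡⟨ cong₂ _+_ (pairs-row m k) (pairs-split second) ⟩
    inner σ k + (pairs (λ v w → m w v ∧ ⌊ w ≟ k ⌋) + pairs (λ v w → m v w ∧ away k v w))
      ≡⟨ cong (λ s → inner σ k + (s + pairs (λ v w → m v w ∧ away k v w)))
           (trans (≡-sym (pairs-flip (λ v w → m v w ∧ ⌊ v ≟ k ⌋))) (pairs-row m k)) ⟩
    inner σ k + (inner σ k + pairs (λ v w → m v w ∧ away k v w))
      ≡⟨ +-assoc (inner σ k) (inner σ k) _ ⟨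
    (inner σ k + inner σ k) + pairs (λ v w → m v w ∧ away k v w) ∎
    where
    open ≡-Reasoning
    m = monochromatic σ
    split : ∀ p q r → p ∧ q ∧ r ≡ false → ⟦ p ∧ not q ⟧ ≡ ⟦ p ∧ r ⟧ + ⟦ p ∧ not q ∧ not r ⟧
    split false q     r     _ = refl
    split true  true  true  ()
    split true  true  false _ = refl
    split true  false true  _ = refl
    split true  false false _ = refl
    m-sym : ∀ v w → m v w ≡ m w v
    m-sym v w = cong₂ _∧_ (SimpleGraph.sym G v w) (==-comm (σ v) (σ w))
    loop : ∀ v w → m v w ∧ ⌊ v ≟ k ⌋ ∧ ⌊ w ≟ k ⌋ ≡ false
    loop v w with v ≟ k | w ≟ k
    ... | no _     | _        = ∧-zeroʳ (m v w)
    ... | yes _    | no _     = ∧-zeroʳ (m v w)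
    ... | yes refl | yes refl rewrite irrefl G v = refl
    second : ∀ v w → ⟦ m v w ∧ not ⌊ v ≟ k ⌋ ⟧ ≡ ⟦ m w v ∧ ⌊ w ≟ k ⌋ ⟧ + ⟦ m v w ∧ away k v w ⟧
    second v w rewrite ≡-sym (m-sym v w) = split (m v w) ⌊ v ≟ k ⌋ ⌊ w ≟ k ⌋ (loop v w)

  move : (Fin n → Bool) → Fin n → Fin n → Bool
  move σ k v = σ v xor ⌊ v ≟ k ⌋

  move-inner : ∀ σ k → inner (move σ k) k ≡ outer σ k
  move-inner σ k = count-cong moved
    where
    flip-== : ∀ a b → ((a xor true) == (b xor false)) ≡ not (a == b)
    flip-== true  true  = refl
    flip-== true  false = refl
    flip-== false true  = refl
    flip-== false false = refl
    moved : ∀ w → adj G k w ∧ (move σ k k == move σ k w) ≡ adj G k w ∧ not (σ k == σ w)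
    moved w with adj G k w in a
    ... | false = refl
    ... | true rewrite ≟-refl k | ≟-false (adj-irrefl G a ∘ ≡-sym) = flip-== (σ k) (σ w)

  move-away : ∀ σ k v w → monochromatic (move σ k) v w ∧ away k v w ≡ monochromatic σ v w ∧ away k v w
  move-away σ k v w with v ≟ k | w ≟ k
  ... | yes _ | _     = trans (∧-zeroʳ _) (≡-sym (∧-zeroʳ _))
  ... | no _  | yes _ = trans (∧-zeroʳ _) (≡-sym (∧-zeroʳ _))
  ... | no _  | no _  rewrite xor-identityʳ (σ v) | xor-identityʳ (σ w) = refl

  -- By `pairs-touching` only the two terms at `k` change, and moving `k` replaces its inner degree
  -- by its outer degree in each of them.
  move-decreases : ∀ σ k → outer σ k < inner σ k → pairs (monochromatic (move σ k)) < pairs (monochromatic σ)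
  move-decreases σ k lt = begin-strict
    pairs (monochromatic (move σ k))
      ≡⟨ pairs-touching (move σ k) k ⟩
    (inner (move σ k) k + inner (move σ k) k) + pairs (λ v w → monochromatic (move σ k) v w ∧ away k v w)
      ≡⟨ cong₂ _+_ (cong₂ _+_ (move-inner σ k) (move-inner σ k)) (pairs-cong (move-away σ k)) ⟩
    (outer σ k + outer σ k) + pairs (λ v w → monochromatic σ v w ∧ away k v w)
      <⟨ +-monoˡ-< _ (+-mono-< lt lt) ⟩
    (inner σ k + inner σ k) + pairs (λ v w → monochromatic σ v w ∧ away k v w)
      ≡⟨ pairs-touching σ k ⟨
    pairs (monochromatic σ) ∎
    where open ≤-Reasoning

  -- Local search: as long as some vertex has more neighbours on its own side, it is moved across.
  -- The number of monochromatic pairs drops with each move, so the search ends.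
  unfriendly-partition : Σ (Fin n → Bool) λ σ → ∀ v → inner σ v ≤ outer σ v
  unfriendly-partition = descend (λ _ → true) (<-wellFounded _)
    where
    descend : ∀ σ → Acc _<_ (pairs (monochromatic σ)) → Σ (Fin n → Bool) λ σ → ∀ v → inner σ v ≤ outer σ v
    descend σ (acc rec) with Fin.any? (λ v → outer σ v <? inner σ v)
    ... | yes (k , lt) = descend (move σ k) (rec (move-decreases σ k lt))
    ... | no none      = σ , λ v → ≮⇒≥ (λ lt → none (v , lt))

-- The colouring away from the roots

-- In inner-colour τ a b a′ b′, one mate has a red and b blue edges to the other side, the
-- other has a′ and b′.  If a mate has a single such edge, the edge between the mates gets
-- the opposite colour.
inner-colour : Bool → ℕ → ℕ → ℕ → ℕ → Bool
inner-colour τ 1 0 _ _ = false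
inner-colour τ _ _ 1 0 = false
inner-colour τ 0 1 _ _ = true
inner-colour τ _ _ 0 1 = true
inner-colour τ 2 0 1 1 = not τ
inner-colour τ 1 1 2 0 = not τ
inner-colour τ _ _ _ _ = τ

-- The first argument counts the red edges to the other side.  A vertex of odd degree has
-- red and blue totals of the same parity, so giving red the parity τ also gives it to blue.
paint : ℕ → ℕ → ℕ → Bool → Bool
paint zero    red blue τ = not (odd blue xor τ)
paint (suc _) red blue τ = odd red xor τ

xor-cancel : ∀ a b → a xor (a xor b) ≡ b
xor-cancel true  true  = refl
xor-cancel true  false = refl
xor-cancel false b     = refl

-- The vertex is painted red exactly when the red edges alone miss the parity `τ`; `paint-blue` is
-- the same with blue.
paint-red : ∀ a r b τ → odd (r + ⟦ paint (suc a) r b τ == true ⟧) ≡ τ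
paint-red a r b τ = trans (odd-+ r _) (trans
  (cong (odd r xor_) (trans (odd-⟦⟧ (odd r xor τ == true)) (==-true (odd r xor τ)))) (xor-cancel (odd r) τ))
  where
  ==-true : ∀ x → (x == true) ≡ x
  ==-true true  = refl
  ==-true false = refl

paint-blue : ∀ r b τ → odd (b + ⟦ paint 0 r b τ == false ⟧) ≡ τ
paint-blue r b τ = trans (odd-+ b _) (trans
  (cong (odd b xor_) (trans (odd-⟦⟧ (not (odd b xor τ) == false)) (==-false (odd b xor τ)))) (xor-cancel (odd b) τ))
  where
  ==-false : ∀ x → (not x == false) ≡ x
  ==-false true  = refl
  ==-false false = refl

paint-both : ∀ a r b τ → odd (r + b) ≡ true → odd (b + ⟦ paint (suc a) r b τ == false ⟧) ≡ τ
paint-both a r b τ e = trans (odd-+ b _) (trans (cong (odd b xor_) (odd-⟦⟧ (odd r xor τ == false)))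
  (opposite (odd r) (odd b) τ (trans (≡-sym (odd-+ r b)) e)))
  where
  opposite : ∀ r b τ → r xor b ≡ true → b xor (r xor τ == false) ≡ τ
  opposite true  false true  _ = refl
  opposite true  false false _ = refl
  opposite false true  true  _ = refl
  opposite false true  false _ = refl

-- The possible numbers of red and blue edges to the other side at a vertex with a mate: at least
-- one edge because the partition is unfriendly, at most two because the degree is at most 3.
data Sides : ℕ → ℕ → Set where
  R  : Sides 1 0
  B  : Sides 0 1
  RR : Sides 2 0
  RB : Sides 1 1
  BB : Sides 0 2

sides : ∀ {x y} → 1 ≤ x + y → x + y ≤ 2 → Sides x y
sides {0} {1} _ _ = B
sides {0} {2} _ _ = BB
sides {1} {0} _ _ = R
sides {1} {1} _ _ = RB
sides {2} {0} _ _ = RR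
sides {0} {suc (suc (suc _))} _ (s≤s (s≤s ()))
sides {1} {suc (suc _)} _ (s≤s (s≤s ()))
sides {2} {suc _} _ (s≤s (s≤s ()))
sides {suc (suc (suc _))} _ (s≤s (s≤s ()))

inner-colour-sym : ∀ {a b a′ b′} → Sides a b → Sides a′ b′ → ∀ τ →
                   inner-colour τ a b a′ b′ ≡ inner-colour τ a′ b′ a b
inner-colour-sym R  R  τ = refl
inner-colour-sym R  B  τ = refl
inner-colour-sym R  RR τ = refl
inner-colour-sym R  RB τ = refl
inner-colour-sym R  BB τ = refl
inner-colour-sym B  R  τ = refl
inner-colour-sym B  B  τ = refl
inner-colour-sym B  RR τ = refl
inner-colour-sym B  RB τ = refl
inner-colour-sym B  BB τ = refl
inner-colour-sym RR R  τ = refl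
inner-colour-sym RR B  τ = refl
inner-colour-sym RR RR τ = refl
inner-colour-sym RR RB τ = refl
inner-colour-sym RR BB τ = refl
inner-colour-sym RB R  τ = refl
inner-colour-sym RB B  τ = refl
inner-colour-sym RB RR τ = refl
inner-colour-sym RB RB τ = refl
inner-colour-sym RB BB τ = refl
inner-colour-sym BB R  τ = refl
inner-colour-sym BB B  τ = refl
inner-colour-sym BB RR τ = refl
inner-colour-sym BB RB τ = refl
inner-colour-sym BB BB τ = refl

select : Bool → ℕ → ℕ → ℕ
select true  a b = a
select false a b = b

-- The total of colour `c` at a vertex with `a` red and `b` blue edges to the other side, an edge of
-- colour `x` to its mate, and the colour assigned by `paint`.
mate-total : ℕ → ℕ → Bool → Bool → Bool → ℕ
mate-total a b x τ c =
  (select c a b + ⟦ x == c ⟧) + ⟦ paint a (a + ⟦ x == true ⟧) (b + ⟦ x == false ⟧) τ == c ⟧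

-- The T-join supplies the first alternative; mates of different degree satisfy the second.
Unlike : ℕ → ℕ → ℕ → ℕ → Set
Unlike a b a′ b′ = (odd a xor odd a′ ≡ true) ⊎ (a + b ≢ a′ + b′)

-- A finite check: once `Sides` and `τ` are known, both totals evaluate to numerals. Pairs that
-- agree in size and in red parity are excluded by `Unlike`.
mate-totals-differ : ∀ {a b a′ b′} → Sides a b → Sides a′ b′ → ∀ τ → Unlike a b a′ b′ →
  let x = inner-colour τ a b a′ b′ in mate-total a b x τ x ≢ mate-total a′ b′ x τ x
mate-totals-differ R  R  τ (inj₁ ())
mate-totals-differ R  R  τ (inj₂ ne) = ⊥-elim (ne refl)
mate-totals-differ B  B  τ (inj₁ ())
mate-totals-differ B  B  τ (inj₂ ne) = ⊥-elim (ne refl)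
mate-totals-differ RR RR τ (inj₁ ())
mate-totals-differ RR RR τ (inj₂ ne) = ⊥-elim (ne refl)
mate-totals-differ RR BB τ (inj₁ ())
mate-totals-differ RR BB τ (inj₂ ne) = ⊥-elim (ne refl)
mate-totals-differ BB RR τ (inj₁ ())
mate-totals-differ BB RR τ (inj₂ ne) = ⊥-elim (ne refl)
mate-totals-differ BB BB τ (inj₁ ())
mate-totals-differ BB BB τ (inj₂ ne) = ⊥-elim (ne refl)
mate-totals-differ RB RB τ (inj₁ ())
mate-totals-differ R  B  true  _ ()
mate-totals-differ R  B  false _ ()
mate-totals-differ R  RR true  _ ()
mate-totals-differ R  RR false _ ()
mate-totals-differ R  RB true  _ ()
mate-totals-differ R  RB false _ ()
mate-totals-differ R  BB true  _ ()
mate-totals-differ R  BB false _ ()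
mate-totals-differ B  R  true  _ ()
mate-totals-differ B  R  false _ ()
mate-totals-differ B  RR true  _ ()
mate-totals-differ B  RR false _ ()
mate-totals-differ B  RB true  _ ()
mate-totals-differ B  RB false _ ()
mate-totals-differ B  BB true  _ ()
mate-totals-differ B  BB false _ ()
mate-totals-differ RR R  true  _ ()
mate-totals-differ RR R  false _ ()
mate-totals-differ RR B  true  _ ()
mate-totals-differ RR B  false _ ()
mate-totals-differ RR RB true  _ ()
mate-totals-differ RR RB false _ ()
mate-totals-differ RB R  true  _ ()
mate-totals-differ RB R  false _ ()
mate-totals-differ RB B  true  _ ()
mate-totals-differ RB B  false _ ()
mate-totals-differ RB RR true  _ ()
mate-totals-differ RB RR false _ ()
mate-totals-differ RB BB true  _ ()
mate-totals-differ RB BB false _ ()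
mate-totals-differ BB R  true  _ ()
mate-totals-differ BB R  false _ ()
mate-totals-differ BB B  true  _ ()
mate-totals-differ BB B  false _ ()
mate-totals-differ BB RB true  _ ()
mate-totals-differ BB RB false _ ()
mate-totals-differ RB RB τ (inj₂ ne) = ⊥-elim (ne refl)

∧-falseˡ : ∀ {a} b → a ≡ false → a ∧ b ≡ false
∧-falseˡ b refl = refl

nbrs-cong : ∀ {n} (G : SimpleGraph n) {p q : Fin n → Fin n → Bool} v →
            (∀ {w} → adj G v w ≡ true → p v w ≡ q v w) → nbrs G p v ≡ nbrs G q v
nbrs-cong G {p} {q} v eq = count-cong pointwise
  where
  pointwise : ∀ w → adj G v w ∧ p v w ≡ adj G v w ∧ q v w
  pointwise w with adj G v w in a
  ... | true  = eq a
  ... | false = refl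

nbrs-partition : ∀ {n} (G : SimpleGraph n) (p q : Fin n → Fin n → Bool) v →
  nbrs G p v ≡ nbrs G (λ v w → q v w ∧ p v w) v + nbrs G (λ v w → not (q v w) ∧ p v w) v
nbrs-partition G p q v = count-split (λ w → split (adj G v w) (p v w) (q v w))
  where
  split : ∀ a p q → ⟦ a ∧ p ⟧ ≡ ⟦ a ∧ q ∧ p ⟧ + ⟦ a ∧ not q ∧ p ⟧
  split false p     q     = refl
  split true  p     true  = ≡-sym (+-identityʳ ⟦ p ⟧)
  split true  p     false = refl

nbrs≡0 : ∀ {n} (G : SimpleGraph n) (p : Fin n → Fin n → Bool) {v w} →
         nbrs G p v ≡ 0 → adj G v w ≡ true → p v w ≡ false
nbrs≡0 G p {v} {w} e a with count≡0⇒false (λ w → adj G v w ∧ p v w) e w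
... | z rewrite a = z

nbrs>0 : ∀ {n} (G : SimpleGraph n) (p : Fin n → Fin n → Bool) {v w} →
         adj G v w ≡ true → p v w ≡ true → 1 ≤ nbrs G p v
nbrs>0 G p {v} {w} a e = count>0 (λ w → adj G v w ∧ p v w) w (cong₂ _∧_ a e)

half-bound : ∀ {i o} → i ≤ o → o + i ≤ 3 → i ≤ 1
half-bound {zero} _ _ = z≤n
half-bound {suc zero} _ _ = s≤s z≤n
half-bound {suc (suc i)} {suc (suc o)} _ (s≤s (s≤s le)) with ≤-trans (m≤n+m (suc (suc i)) o) le
... | s≤s ()
half-bound {suc (suc i)} {zero} ()
half-bound {suc (suc i)} {suc zero} (s≤s ())

-- The default colouring and its totals

module Default {n : ℕ} (G : SimpleGraph n) (subcubic : Subcubic G)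
  (σ : Fin n → Bool) (unfriendly : ∀ v → inner G σ v ≤ outer G σ v)
  (root : Fin n → Fin n) (root-edge : ∀ {u v} → adj G u v ≡ true → root u ≡ root v)
  (χ : Fin n → Fin n → Bool) (χ-sym : Symmetric G χ)
  where

  same : Fin n → Fin n → Bool
  same v w = σ v == σ w

  same⇒≡ : ∀ {v w} → same v w ≡ true → σ v ≡ σ w
  same⇒≡ {v} {w} e with σ v | σ w
  ... | true  | true  = refl
  ... | false | false = refl

  same-sym : ∀ {v w c} → same v w ≡ c → same w v ≡ c
  same-sym {v} {w} e with σ v | σ w
  ... | true  | true  = e
  ... | true  | false = e
  ... | false | true  = e
  ... | false | false = e

  cross : Bool → Fin n → ℕ
  cross c = nbrs G (λ v w → not (same v w) ∧ (χ v w == c))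

  mates : Fin n → ℕ
  mates = inner G σ

  degree≡outer : ∀ v → degree G v ≡ outer G σ v + mates v
  degree≡outer v = trans (count-partition (adj G v) (same v)) (+-comm (mates v) (outer G σ v))

  mates≤1 : ∀ v → mates v ≤ 1
  mates≤1 v = half-bound (unfriendly v) (subst (_≤ 3) (degree≡outer v) (subcubic v))

  outer≡ : ∀ v → outer G σ v ≡ cross true v + cross false v
  outer≡ v = count-split (λ w → split (adj G v w) (not (same v w)) (χ v w))
    where
    split : ∀ a q x → ⟦ a ∧ q ⟧ ≡ ⟦ a ∧ q ∧ (x == true) ⟧ + ⟦ a ∧ q ∧ (x == false) ⟧
    split false q     x     = refl
    split true  false x     = refl
    split true  true  true  = refl
    split true  true  false = refl

  degree≡ : ∀ v → degree G v ≡ (cross true v + cross false v) + mates v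
  degree≡ v = trans (degree≡outer v) (cong (_+ mates v) (outer≡ v))

  mates≡1 : ∀ {v w} → adj G v w ≡ true → same v w ≡ true → mates v ≡ 1
  mates≡1 {v} a s = ≤-antisym (mates≤1 v) (nbrs>0 G same a s)

  mate-sides : ∀ v → mates v ≡ 1 → Sides (cross true v) (cross false v)
  mate-sides v e = sides
    (subst (_≤ cross true v + cross false v) e (subst (mates v ≤_) (outer≡ v) (unfriendly v)))
    (+-cancelʳ-≤ 1 _ 2 (subst (λ i → (cross true v + cross false v) + i ≤ 3) e (subst (_≤ 3) (degree≡ v) (subcubic v))))

  nbrs-mate : ∀ (p : Fin n → Fin n → Bool) {v w} → adj G v w ≡ true → same v w ≡ true →
              nbrs G (λ v w → same v w ∧ p v w) v ≡ ⟦ p v w ⟧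
  nbrs-mate p {v} {w} a s = trans (count-supported _ w off) (cong ⟦_⟧ (cong₂ _∧_ a (cong (_∧ p v w) s)))
    where
    off : ∀ j → j ≢ w → adj G v j ∧ same v j ∧ p v j ≡ false
    off j ne with adj G v j in aj | same v j in sj
    ... | false | _     = refl
    ... | true  | false = refl
    ... | true  | true  =
      ⊥-elim (ne (count≡1⇒unique (λ w → adj G v w ∧ same v w) (mates≡1 a s) (cong₂ _∧_ aj sj) (cong₂ _∧_ a s)))

  nbrs-no-mate : ∀ (p : Fin n → Fin n → Bool) {v} → mates v ≡ 0 → nbrs G (λ v w → same v w ∧ p v w) v ≡ 0
  nbrs-no-mate p {v} e = count-empty off
    where
    off : ∀ j → adj G v j ∧ same v j ∧ p v j ≡ false
    off j with adj G v j in aj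
    ... | false = refl
    ... | true  = ∧-falseˡ (p v j) (nbrs≡0 G same e aj)

  -- The parity aimed at, `false` meaning even. Comparing with the side of the root gives the root
  -- itself the even target, and adjacent vertices on different sides opposite targets.
  τ : Fin n → Bool
  τ v = σ v xor σ (root v)

  -- Between mates `χ` acts only through its boundary, that is, through the parities of the red
  -- edges to the other side; the colour there is read off from the resulting counts.
  ec : Fin n → Fin n → Bool
  ec v w = if same v w
    then inner-colour (τ v) (cross true v) (cross false v) (cross true w) (cross false w)
    else χ v w

  ρ : Bool → Fin n → ℕ
  ρ c = nbrs G (λ v w → ec v w == c)

  vc : Fin n → Bool
  vc v = paint (cross true v) (ρ true v) (ρ false v) (τ v)

  ec-mate : ∀ {v w} → same v w ≡ true →
    ec v w ≡ inner-colour (τ v) (cross true v) (cross false v) (cross true w) (cross false w)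
  ec-mate s rewrite s = refl

  ec-cross : ∀ {v w} → same v w ≡ false → ec v w ≡ χ v w
  ec-cross s rewrite s = refl

  τ-mate : ∀ {v w} → adj G v w ≡ true → same v w ≡ true → τ v ≡ τ w
  τ-mate a s = cong₂ _xor_ (same⇒≡ s) (cong σ (root-edge a))

  τ-cross : ∀ {v w} → adj G v w ≡ true → same v w ≡ false → τ v ≢ τ w
  τ-cross {v} {w} a s rewrite root-edge a with σ v | σ w | σ (root w)
  ... | true  | false | true  = λ ()
  ... | true  | false | false = λ ()
  ... | false | true  | true  = λ ()
  ... | false | true  | false = λ ()

  ec-sym : ∀ {v w} → adj G v w ≡ true → ec v w ≡ ec w v
  ec-sym {v} {w} a with same v w in s
  ... | false = trans (χ-sym v w) (≡-sym (ec-cross (same-sym s)))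
  ... | true  = begin
    inner-colour (τ v) (cross true v) (cross false v) (cross true w) (cross false w)
      ≡⟨ inner-colour-sym (mate-sides v (mates≡1 a s)) (mate-sides w (mates≡1 a′ s′)) (τ v) ⟩
    inner-colour (τ v) (cross true w) (cross false w) (cross true v) (cross false v)
      ≡⟨ cong (λ t → inner-colour t (cross true w) (cross false w) (cross true v) (cross false v)) (τ-mate a s) ⟩
    inner-colour (τ w) (cross true w) (cross false w) (cross true v) (cross false v)
      ≡⟨ ec-mate s′ ⟨
    ec w v ∎
    where
    open ≡-Reasoning
    a′ = adj-sym G a
    s′ = same-sym s

  ρ≡ : ∀ c v → ρ c v ≡ nbrs G (λ v w → same v w ∧ (ec v w == c)) v + cross c v
  ρ≡ c v = trans (nbrs-partition G (λ v w → ec v w == c) same v)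
    (cong (nbrs G (λ v w → same v w ∧ (ec v w == c)) v +_) (nbrs-cong G {λ v w → not (same v w) ∧ (ec v w == c)} {λ v w → not (same v w) ∧ (χ v w == c)} v (λ {w} _ → cross-ec w)))
    where
    cross-ec : ∀ w → not (same v w) ∧ (ec v w == c) ≡ not (same v w) ∧ (χ v w == c)
    cross-ec w with same v w
    ... | true  = refl
    ... | false = refl

  ρ-mate : ∀ c {v w} → adj G v w ≡ true → same v w ≡ true → ρ c v ≡ cross c v + ⟦ ec v w == c ⟧
  ρ-mate c {v} {w} a s = trans (ρ≡ c v) (trans
    (cong (_+ cross c v) (nbrs-mate (λ v w → ec v w == c) a s)) (+-comm ⟦ ec v w == c ⟧ (cross c v)))

  ρ-single : ∀ c {v} → mates v ≡ 0 → ρ c v ≡ cross c v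
  ρ-single c {v} e = trans (ρ≡ c v) (cong (_+ cross c v) (nbrs-no-mate (λ v w → ec v w == c) e))

  ρ-sum : ∀ v → ρ true v + ρ false v ≡ degree G v
  ρ-sum v = ≡-sym (count-split (λ w → split (adj G v w) (ec v w)))
    where
    split : ∀ a x → ⟦ a ⟧ ≡ ⟦ a ∧ (x == true) ⟧ + ⟦ a ∧ (x == false) ⟧
    split false x     = refl
    split true  true  = refl
    split true  false = refl

  tot : Bool → Fin n → ℕ
  tot = total G ec vc

  tot-sum : ∀ c v → tot c v + tot (not c) v ≡ degree G v + 1
  tot-sum true v = begin
    (ρ true v + ⟦ vc v == true ⟧) + (ρ false v + ⟦ vc v == false ⟧)
      ≡⟨ +-interchange (ρ true v) ⟦ vc v == true ⟧ (ρ false v) ⟦ vc v == false ⟧ ⟩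
    (ρ true v + ρ false v) + (⟦ vc v == true ⟧ + ⟦ vc v == false ⟧)
      ≡⟨ cong₂ _+_ (ρ-sum v) (one (vc v)) ⟩
    degree G v + 1 ∎
    where
    open ≡-Reasoning
    one : ∀ x → ⟦ x == true ⟧ + ⟦ x == false ⟧ ≡ 1
    one true  = refl
    one false = refl
  tot-sum false v = trans (+-comm (tot false v) (tot true v)) (tot-sum true v)

  cross≡select : ∀ c v → cross c v ≡ select c (cross true v) (cross false v)
  cross≡select true  v = refl
  cross≡select false v = refl

  vc-mate : ∀ {v w} → adj G v w ≡ true → same v w ≡ true →
            vc v ≡ paint (cross true v) (cross true v + ⟦ ec v w == true ⟧) (cross false v + ⟦ ec v w == false ⟧) (τ v)
  vc-mate {v} a s = cong₂ (λ x y → paint (cross true v) x y (τ v)) (ρ-mate true a s) (ρ-mate false a s)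

  tot-mate : ∀ c {v w} → adj G v w ≡ true → same v w ≡ true →
             tot c v ≡ mate-total (cross true v) (cross false v) (ec v w) (τ v) c
  tot-mate c {v} {w} a s = cong₂ _+_
    (trans (ρ-mate c a s) (cong (_+ ⟦ ec v w == c ⟧) (cross≡select c v)))
    (cong (λ x → ⟦ x == c ⟧) (vc-mate a s))

  -- The only vertices for which τ can fail in a colour of an edge to the other side.
  Split : Fin n → Set
  Split v = cross true v ≡ 1 × cross false v ≡ 1 × mates v ≡ 0

  -- With both colours present among the edges to the other side the degree is 2 or 3, and 2 only in
  -- the excluded case.
  odd-degree : ∀ {x y i} → 1 ≤ x → 1 ≤ y → i ≤ 1 → x + y + i ≤ 3 → ¬ (x ≡ 1 × y ≡ 1 × i ≡ 0) → odd (x + y + i) ≡ true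
  odd-degree {1} {1} {0} _ _ _ _ ns = ⊥-elim (ns (refl , refl , refl))
  odd-degree {1} {1} {1} _ _ _ _ _ = refl
  odd-degree {1} {2} {0} _ _ _ _ _ = refl
  odd-degree {2} {1} {0} _ _ _ _ _ = refl
  odd-degree {1} {2} {suc _} _ _ _ (s≤s (s≤s (s≤s ()))) _
  odd-degree {2} {1} {suc _} _ _ _ (s≤s (s≤s (s≤s ()))) _
  odd-degree {1} {suc (suc (suc _))} _ _ _ (s≤s (s≤s (s≤s ()))) _
  odd-degree {2} {suc (suc _)} _ _ _ (s≤s (s≤s (s≤s ()))) _
  odd-degree {suc (suc (suc x))} {suc y} _ _ _ (s≤s (s≤s (s≤s le))) _ rewrite +-suc x y with le
  ... | ()
  odd-degree {1} {1} {suc (suc _)} _ _ (s≤s ()) _ _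

  -- If the edge is red, `paint` gives red the parity `τ`. If it is blue and no red edge crosses,
  -- `paint` serves blue. If both colours cross, the degree is odd by `odd-degree`, and the parity
  -- of red carries over to blue.
  tot-parity : ∀ {v w} → ¬ Split v → adj G v w ≡ true → same v w ≡ false → odd (tot (ec v w) v) ≡ τ v
  tot-parity {v} {w} ns a s with ec v w in e
  ... | true = go (cross true v) refl red
    where
    red : 1 ≤ cross true v
    red = nbrs>0 G (λ v w → not (same v w) ∧ (χ v w == true)) a
      (cong₂ _∧_ (cong not s) (cong (_== true) (trans (≡-sym (ec-cross s)) e)))
    go : ∀ x → cross true v ≡ x → 1 ≤ x → odd (tot true v) ≡ τ v
    go (suc x) eq _ = subst (λ y → odd (ρ true v + ⟦ paint y (ρ true v) (ρ false v) (τ v) == true ⟧) ≡ τ v) (≡-sym eq)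
      (paint-red x (ρ true v) (ρ false v) (τ v))
  ... | false = go (cross true v) refl
    where
    blue : 1 ≤ cross false v
    blue = nbrs>0 G (λ v w → not (same v w) ∧ (χ v w == false)) a
      (cong₂ _∧_ (cong not s) (cong (_== false) (trans (≡-sym (ec-cross s)) e)))
    go : ∀ x → cross true v ≡ x → odd (tot false v) ≡ τ v
    go zero eq = subst (λ y → odd (ρ false v + ⟦ paint y (ρ true v) (ρ false v) (τ v) == false ⟧) ≡ τ v) (≡-sym eq)
      (paint-blue (ρ true v) (ρ false v) (τ v))
    go (suc x) eq = subst (λ y → odd (ρ false v + ⟦ paint y (ρ true v) (ρ false v) (τ v) == false ⟧) ≡ τ v) (≡-sym eq)
      (paint-both x (ρ true v) (ρ false v) (τ v)
        (trans (cong odd (trans (ρ-sum v) (degree≡ v)))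
          (odd-degree (subst (1 ≤_) (≡-sym eq) (s≤s z≤n)) blue (mates≤1 v)
            (subst (_≤ 3) (degree≡ v) (subcubic v)) ns)))

  cross-differ : ∀ {v w} → ¬ Split v → ¬ Split w → adj G v w ≡ true → same v w ≡ false →
                 tot (ec v w) v ≢ tot (ec v w) w
  cross-differ {v} {w} nv nw a s eq = τ-cross a s (trans (≡-sym (tot-parity nv a s)) (trans (cong odd eq)
    (trans (cong (λ c → odd (tot c w)) (ec-sym a)) (tot-parity nw (adj-sym G a) (same-sym s)))))

  mate-differ : ∀ {v w} → Unlike (cross true v) (cross false v) (cross true w) (cross false w) →
                adj G v w ≡ true → same v w ≡ true → tot (ec v w) v ≢ tot (ec v w) w
  mate-differ {v} {w} unlike a s eq =
    subst (λ x → mate-total (cross true v) (cross false v) x (τ v) x ≢ mate-total (cross true w) (cross false w) x (τ v) x)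
      (≡-sym (ec-mate s))
      (mate-totals-differ (mate-sides v (mates≡1 a s)) (mate-sides w (mates≡1 a′ s′)) (τ v) unlike)
      (trans (≡-sym (tot-mate (ec v w) a s)) (trans eq
        (trans (tot-mate (ec v w) a′ s′)
          (cong₂ (λ x t → mate-total (cross true w) (cross false w) x t (ec v w)) (≡-sym (ec-sym a)) (≡-sym (τ-mate a s))))))
    where
    a′ = adj-sym G a
    s′ = same-sym s

-- Counting pairs of mates

odd-sum-supported : ∀ {n} (f : Fin n → ℕ) k → (∀ v → v ≢ k → odd (f v) ≡ false) → odd (sum f) ≡ odd (f k)
odd-sum-supported {suc n} f zero e = trans (odd-+ (f zero) _) (trans
  (cong (odd (f zero) xor_) (even-sum (f ∘ suc) λ v → e (suc v) λ ())) (xor-identityʳ (odd (f zero))))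
  where
  even-sum : ∀ {m} (g : Fin m → ℕ) → (∀ v → odd (g v) ≡ false) → odd (sum g) ≡ false
  even-sum {zero}  g e = refl
  even-sum {suc m} g e = trans (odd-+ (g zero) _) (cong₂ _xor_ (e zero) (even-sum (g ∘ suc) (e ∘ suc)))
odd-sum-supported {suc n} f (suc k) e = trans (odd-+ (f zero) _) (cong₂ _xor_ (e zero λ ())
  (odd-sum-supported (f ∘ suc) k (λ v ne → e (suc v) (ne ∘ Fin.suc-injective))))

-- An orientation of all pairs of distinct vertices. It picks one ordered pair from each unordered
-- one, and thus one of two mates to carry the demand.
before : ∀ {n} → Fin n → Fin n → Bool
before v w = ⌊ v Fin.<? w ⌋

before-flip : ∀ {n} {v w : Fin n} → v ≢ w → before w v ≡ not (before v w)
before-flip {v = v} {w} ne with v Fin.<? w | w Fin.<? v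
... | yes l | yes g = ⊥-elim (Fin.<-asym l g)
... | yes _ | no _  = refl
... | no _  | yes _ = refl
... | no nl | no ng with Fin.<-cmp v w
...   | tri< l _ _ = ⊥-elim (nl l)
...   | tri≈ _ e _ = ⊥-elim (ne e)
...   | tri> _ _ g = ⊥-elim (ng g)

pairs-symmetric : ∀ {n} (p : Fin n → Fin n → Bool) → (∀ v w → p v w ≡ p w v) → (∀ v → p v v ≡ false) →
  pairs p ≡ pairs (λ v w → p v w ∧ before v w) + pairs (λ v w → p v w ∧ before v w)
pairs-symmetric p p-sym p-irrefl = trans
  (pairs-split (λ v w → ⟦⟧-partition (p v w) (before v w)))
  (cong (pairs (λ v w → p v w ∧ before v w) +_)
    (trans (pairs-cong reversed) (≡-sym (pairs-flip (λ v w → p v w ∧ before v w)))))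
  where
  reversed : ∀ v w → p v w ∧ not (before v w) ≡ p w v ∧ before w v
  reversed v w with v ≟ w
  ... | yes refl rewrite p-irrefl v = refl
  ... | no ne rewrite before-flip ne | p-sym v w = refl

double-injective : ∀ {x y} → x + x ≡ y + y → x ≡ y
double-injective {zero}  {zero}  _ = refl
double-injective {suc x} {suc y} e rewrite +-suc x x | +-suc y y =
  cong suc (double-injective (suc-injective (suc-injective e)))

xor≡false : ∀ {a b} → a xor b ≡ false → a ≡ b
xor≡false {true}  {true}  _ = refl
xor≡false {false} {false} _ = refl

-- If all vertices of a component have one mate and two neighbours on the other side,
-- then both sides contain equally many pairs of mates, so the number of pairs is even.
module Counting {n : ℕ} (G : SimpleGraph n) (σ : Fin n → Bool)
  (root : Fin n → Fin n) (root-edge : ∀ {u v} → adj G u v ≡ true → root u ≡ root v)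
  (χ : Fin n → Fin n → Bool) (χ-sym : Symmetric G χ)
  (r : Fin n) (full : ∀ v → root v ≡ r → inner G σ v ≡ 1 × outer G σ v ≡ 2)
  where

  private
    same : Fin n → Fin n → Bool
    same v w = σ v == σ w

    member : Fin n → Bool
    member v = ⌊ root v ≟ r ⌋

    member-edge : ∀ {u v} → adj G u v ≡ true → member u ≡ member v
    member-edge a = cong (λ x → ⌊ x ≟ r ⌋) (root-edge a)

    on : Bool → Fin n → Bool
    on s v = member v ∧ (σ v == s)

    mated crossing ordered : Bool → Fin n → Fin n → Bool
    mated s v w    = on s v ∧ adj G v w ∧ same v w
    crossing s v w = on s v ∧ adj G v w ∧ not (same v w)
    ordered s v w  = mated s v w ∧ before v w

    demanded joined : Fin n → Fin n → Bool
    demanded v w = member v ∧ adj G v w ∧ same v w ∧ before v w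
    joined v w   = member v ∧ adj G v w ∧ χ v w

  -- By `full` every vertex counted has two neighbours on the other side and one mate.
  crossing≡mated : ∀ s → pairs (crossing s) ≡ pairs (mated s) + pairs (mated s)
  crossing≡mated s = trans (sum-cong-≗ row) (∑-distrib-+ (λ v → count (mated s v)) (λ v → count (mated s v)))
    where
    row : ∀ v → count (crossing s v) ≡ count (mated s v) + count (mated s v)
    row v with root v ≟ r
    ... | no _ rewrite count-empty {n} {λ _ → false} (λ _ → refl) = refl
    ... | yes e with σ v == s | full v e
    ...   | true  | m , o rewrite m | o = refl
    ...   | false | _ rewrite count-empty {n} {λ _ → false} (λ _ → refl) = refl

  -- An edge between the sides has one end on each of them, so reversal is a bijection.
  crossing-flip : pairs (crossing true) ≡ pairs (crossing false)
  crossing-flip = trans (pairs-flip (crossing true)) (pairs-cong flipped)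
    where
    sides-swap : ∀ s t m → (m ∧ (s == true)) ∧ not (s == t) ≡ (m ∧ (t == false)) ∧ not (t == s)
    sides-swap s t false = refl
    sides-swap true  true  true = refl
    sides-swap true  false true = refl
    sides-swap false true  true = refl
    sides-swap false false true = refl
    flipped : ∀ v w → crossing true w v ≡ crossing false v w
    flipped v w rewrite SimpleGraph.sym G w v with adj G v w in a
    ... | false = trans (∧-zeroʳ _) (≡-sym (∧-zeroʳ _))
    ... | true rewrite member-edge a = sides-swap (σ w) (σ v) (member w)

  mated-halves : ∀ s → pairs (mated s) ≡ pairs (ordered s) + pairs (ordered s)
  mated-halves s = pairs-symmetric (mated s) mated-sym mated-irrefl
    where
    sides-sym : ∀ a b m → (m ∧ (a == s)) ∧ (a == b) ≡ (m ∧ (b == s)) ∧ (b == a)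
    sides-sym a b false = refl
    sides-sym true  true  true = refl
    sides-sym true  false true = trans (∧-zeroʳ s) (≡-sym (∧-zeroʳ (not s)))
    sides-sym false true  true = trans (∧-zeroʳ (not s)) (≡-sym (∧-zeroʳ s))
    sides-sym false false true = refl
    mated-sym : ∀ v w → mated s v w ≡ mated s w v
    mated-sym v w rewrite SimpleGraph.sym G w v with adj G v w in a
    ... | false = trans (∧-zeroʳ _) (≡-sym (∧-zeroʳ _))
    ... | true rewrite member-edge a = sides-sym (σ v) (σ w) (member w)
    mated-irrefl : ∀ v → mated s v v ≡ false
    mated-irrefl v rewrite irrefl G v = ∧-zeroʳ _

  -- Both sides see the same crossing edges, which are twice the mated ordered pairs and so four
  -- times the pairs of mates; halving twice gives the claim.
  ordered-balanced : pairs (ordered true) ≡ pairs (ordered false)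
  ordered-balanced = double-injective (begin
    pairs (ordered true) + pairs (ordered true)    ≡⟨ mated-halves true ⟨
    pairs (mated true)                             ≡⟨ double-injective (trans (≡-sym (crossing≡mated true)) (trans crossing-flip (crossing≡mated false))) ⟩
    pairs (mated false)                            ≡⟨ mated-halves false ⟩
    pairs (ordered false) + pairs (ordered false)  ∎)
    where open ≡-Reasoning

  -- The total demand is the number of pairs of mates in the component, a sum of two equal numbers,
  -- one for each side.
  demanded-even : odd (pairs demanded) ≡ false
  demanded-even = trans (cong odd (trans
    (pairs-split {p = demanded} {ordered true} {ordered false} (λ v w → split (member v) (σ v) (adj G v w) (same v w) (before v w)))
    (cong (_+ pairs (ordered false)) ordered-balanced))) (odd-double (pairs (ordered false)))
    where
    split : ∀ m s a e l → ⟦ m ∧ a ∧ e ∧ l ⟧ ≡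
      ⟦ ((m ∧ (s == true)) ∧ a ∧ e) ∧ l ⟧ + ⟦ ((m ∧ (s == false)) ∧ a ∧ e) ∧ l ⟧
    split false s     a     e     l = refl
    split true  true  false e     l = refl
    split true  true  true  false l = refl
    split true  true  true  true  l = ≡-sym (+-identityʳ ⟦ l ⟧)
    split true  false false e     l = refl
    split true  false true  false l = refl
    split true  false true  true  l = refl

  -- The handshake lemma for `χ` inside the component.
  joined-even : odd (pairs joined) ≡ false
  joined-even = trans (cong odd (pairs-symmetric joined joined-sym joined-irrefl)) (odd-double (pairs (λ v w → joined v w ∧ before v w)))
    where
    joined-sym : ∀ v w → joined v w ≡ joined w v
    joined-sym v w rewrite SimpleGraph.sym G w v with adj G v w in a
    ... | false = trans (∧-zeroʳ _) (≡-sym (∧-zeroʳ _))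
    ... | true rewrite member-edge a | χ-sym v w = refl
    joined-irrefl : ∀ v → joined v v ≡ false
    joined-irrefl v rewrite irrefl G v = ∧-zeroʳ _

  -- Boundary plus demand is summed over the component. The sum is even, and so is each term other
  -- than the one at `r`; hence that one is even too.
  root-met : (∀ {v} → root v ≢ v → boundary G χ v ≡ odd (nbrs G (λ v w → same v w ∧ before v w) v)) →
             root r ≡ r → boundary G χ r ≡ odd (nbrs G (λ v w → same v w ∧ before v w) r)
  root-met met e = xor≡false (begin
    boundary G χ r xor odd (nbrs G (λ v w → same v w ∧ before v w) r)  ≡⟨ member-row (cong (λ x → ⌊ x ≟ r ⌋) e) ⟨
    odd (row r)                                                       ≡⟨ odd-sum-supported row r even-row ⟨
    odd (sum row)                                                     ≡⟨ cong odd (∑-distrib-+ (count ∘ joined) (count ∘ demanded)) ⟩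
    odd (pairs joined + pairs demanded)                               ≡⟨ odd-+ (pairs joined) (pairs demanded) ⟩
    odd (pairs joined) xor odd (pairs demanded)                       ≡⟨ cong₂ _xor_ joined-even demanded-even ⟩
    false                                                             ∎)
    where
    open ≡-Reasoning
    row : Fin n → ℕ
    row v = count (joined v) + count (demanded v)
    member-row : ∀ {v} → ⌊ root v ≟ r ⌋ ≡ ⌊ r ≟ r ⌋ →
      odd (row v) ≡ boundary G χ v xor odd (nbrs G (λ v w → same v w ∧ before v w) v)
    member-row {v} m rewrite m | ≟-refl r = odd-+ (nbrs G χ v) _
    even-row : ∀ v → v ≢ r → odd (row v) ≡ false
    even-row v ne with root v ≟ r
    ... | no _ rewrite count-empty {n} {λ _ → false} (λ _ → refl) = refl
    ... | yes e′ = trans (odd-+ (nbrs G χ v) _)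
      (trans (cong (_xor odd (nbrs G (λ v w → same v w ∧ before v w) v)) (met (λ e″ → ne (trans (≡-sym e″) e′)))) (xor-same (odd (nbrs G (λ v w → same v w ∧ before v w) v))))

-- Repairs at the roots

-- The arguments are the number of mates that are cubic together with the vertex, the number of all
-- mates, and the degree. The value 1 marks degree 2 without a mate, the only vertices that can be
-- `Split`.
rank : ℕ → ℕ → ℕ → ℕ
rank (suc _) _ _ = 0
rank 0       0 2 = 1
rank 0       _ _ = 2

module Priority {n : ℕ} (G : SimpleGraph n) (σ : Fin n → Bool) where

  cubic : Fin n → Bool
  cubic v = ⌊ degree G v ℕ.≟ 3 ⌋

  cubic-mates : Fin n → ℕ
  cubic-mates = nbrs G (λ v w → (σ v == σ w) ∧ (cubic v ∧ cubic w))

  -- When two trees are joined the root of higher priority survives: vertices of priority 2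
  -- tolerate any parity, priority 1 leaves only neighbours of priority at most 1, and
  -- priority 0 roots never violate their demand.
  priority : Fin n → ℕ
  priority v = rank (cubic-mates v) (inner G σ v) (degree G v)

  cubic⇒3 : ∀ {v} → cubic v ≡ true → degree G v ≡ 3
  cubic⇒3 {v} e with degree G v ℕ.≟ 3
  ... | yes d = d
  ... | no _  = true≢false e refl

  3⇒cubic : ∀ {v} → degree G v ≡ 3 → cubic v ≡ true
  3⇒cubic {v} e with degree G v ℕ.≟ 3
  ... | yes _ = refl
  ... | no ne = ⊥-elim (ne e)

  CubicMate : Fin n → Set
  CubicMate v = inner G σ v ≢ 0 × degree G v ≡ 3

  cubic-mate : ∀ {v} → 1 ≤ cubic-mates v → CubicMate v
  cubic-mate {v} le with count-witness (λ w → adj G v w ∧ (σ v == σ w) ∧ (cubic v ∧ cubic w)) le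
  ... | w , e with ∧-true {adj G v w} e
  ...   | a , e′ with ∧-true {σ v == σ w} e′
  ...     | s , e″ =
    (λ m → true≢false s (nbrs≡0 G (λ v w → σ v == σ w) m a)) , cubic⇒3 (proj₁ (∧-true {cubic v} e″))

  priority≤0 : ∀ {v} → priority v ≤ 0 → CubicMate v
  priority≤0 {v} = go (cubic-mates v) (inner G σ v) (degree G v) refl
    where
    go : ∀ x i d → cubic-mates v ≡ x → rank x i d ≤ 0 → CubicMate v
    go (suc x) i d e _ = cubic-mate (subst (1 ≤_) (≡-sym e) (s≤s z≤n))
    go 0 0 0 _ ()
    go 0 0 1 _ ()
    go 0 0 2 _ ()
    go 0 0 (suc (suc (suc _))) _ ()
    go 0 (suc _) _ _ ()

  priority≤1 : ∀ {v} → priority v ≤ 1 → CubicMate v ⊎ (inner G σ v ≡ 0 × degree G v ≡ 2)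
  priority≤1 {v} = go (cubic-mates v) (inner G σ v) (degree G v) refl refl refl
    where
    go : ∀ x i d → cubic-mates v ≡ x → inner G σ v ≡ i → degree G v ≡ d → rank x i d ≤ 1 →
         CubicMate v ⊎ (inner G σ v ≡ 0 × degree G v ≡ 2)
    go (suc x) i d e _ _ _ = inj₁ (cubic-mate (subst (1 ≤_) (≡-sym e) (s≤s z≤n)))
    go 0 0 2 _ ei ed _ = inj₂ (ei , ed)
    go 0 0 0 _ _ _ (s≤s ())
    go 0 0 1 _ _ _ (s≤s ())
    go 0 0 (suc (suc (suc _))) _ _ _ (s≤s ())
    go 0 (suc _) _ _ _ _ (s≤s ())

-- Differing totals away from the roots

module Solution {n : ℕ} (G : SimpleGraph n) (subcubic : Subcubic G)
  (σ : Fin n → Bool) (unfriendly : ∀ v → inner G σ v ≤ outer G σ v)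
  (root : Fin n → Fin n) (root-edge : ∀ {u v} → adj G u v ≡ true → root u ≡ root v)
  (root-max : ∀ v → Priority.priority G σ v ≤ Priority.priority G σ (root v))
  (χ : Fin n → Fin n → Bool) (χ-sym : Symmetric G χ)
  (met : ∀ {v} → root v ≢ v →
    boundary G χ v ≡ odd (nbrs G (λ v w → (σ v == σ w) ∧ before v w) v))
  where

  open Priority G σ
  open Default G subcubic σ unfriendly root root-edge χ χ-sym
  open Repairs G ec vc ec-sym root root-edge

  demand : Fin n → Bool
  demand v = odd (nbrs G (λ v w → same v w ∧ before v w) v)

  nbrs-χ : ∀ v → nbrs G χ v ≡ nbrs G (λ v w → same v w ∧ χ v w) v + cross true v
  nbrs-χ v = trans (nbrs-partition G χ same v)
    (cong (nbrs G (λ v w → same v w ∧ χ v w) v +_)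
      (nbrs-cong G {λ v w → not (same v w) ∧ χ v w} {λ v w → not (same v w) ∧ (χ v w == true)} v
        (λ {w} _ → cong (not (same v w) ∧_) (≡-true (χ v w)))))
    where
    ≡-true : ∀ x → x ≡ (x == true)
    ≡-true true  = refl
    ≡-true false = refl

  -- Without a mate the demand is zero and all edges at `v` cross, so the boundary is the parity of
  -- the red crossing edges.
  single-even : ∀ {v} → mates v ≡ 0 → boundary G χ v ≡ demand v → odd (cross true v) ≡ false
  single-even {v} m e = begin
    odd (cross true v)   ≡⟨ cong (λ x → odd (x + cross true v)) (nbrs-no-mate χ m) ⟨
    odd (nbrs G (λ v w → same v w ∧ χ v w) v + cross true v) ≡⟨ cong odd (nbrs-χ v) ⟨
    boundary G χ v       ≡⟨ e ⟩
    demand v             ≡⟨ cong odd (nbrs-no-mate before m) ⟩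
    false                ∎
    where open ≡-Reasoning

  mate-demand : ∀ {v w} → adj G v w ≡ true → same v w ≡ true → boundary G χ v ≡ demand v →
                χ v w xor odd (cross true v) ≡ before v w
  mate-demand {v} {w} a s e = begin
    χ v w xor odd (cross true v)          ≡⟨ cong (_xor odd (cross true v)) (odd-⟦⟧ (χ v w)) ⟨
    odd ⟦ χ v w ⟧ xor odd (cross true v)  ≡⟨ odd-+ ⟦ χ v w ⟧ (cross true v) ⟨
    odd (⟦ χ v w ⟧ + cross true v)        ≡⟨ cong (λ x → odd (x + cross true v)) (nbrs-mate χ a s) ⟨
    odd (nbrs G (λ v w → same v w ∧ χ v w) v + cross true v) ≡⟨ cong odd (nbrs-χ v) ⟨
    boundary G χ v                        ≡⟨ e ⟩
    demand v                              ≡⟨ cong odd (nbrs-mate before a s) ⟩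
    odd ⟦ before v w ⟧                    ≡⟨ odd-⟦⟧ (before v w) ⟩
    before v w                            ∎
    where open ≡-Reasoning

  -- In the sum of the two instances of `mate-demand` the common value of `χ` on the edge between
  -- the mates cancels, while the two orientation bits are opposite. So the parities of the red
  -- crossing edges differ.
  mates-unlike : ∀ {v w} → adj G v w ≡ true → same v w ≡ true →
    boundary G χ v ≡ demand v → boundary G χ w ≡ demand w →
    Unlike (cross true v) (cross false v) (cross true w) (cross false w)
  mates-unlike {v} {w} a s ev ew = inj₁ (solve (χ v w) _ _ (before v w) (mate-demand a s ev)
    (trans (cong (_xor odd (cross true w)) (χ-sym v w))
      (trans (mate-demand (adj-sym G a) (same-sym s) ew) (before-flip (adj-irrefl G a)))))
    where
    solve : ∀ x a b l → x xor a ≡ l → x xor b ≡ not l → a xor b ≡ true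
    solve true  true  b     .false refl e = e
    solve true  false true  .true  refl e = refl
    solve true  false false .true  refl ()
    solve false true  b     .true  refl e = cong not e
    solve false false b     .false refl e = e

  nonroot-nonsplit : ∀ {v} → root v ≢ v → ¬ Split v
  nonroot-nonsplit nr (one , _ , m) with trans (cong odd (≡-sym one)) (single-even m (met nr))
  ... | ()

  nonroot-ok : ∀ {u v} → adj G u v ≡ true → root u ≢ u → root v ≢ v → tot (ec u v) u ≢ tot (ec u v) v
  nonroot-ok {u} {v} a nu nv with same u v in s
  ... | true  = subst (λ x → tot x u ≢ tot x v) (ec-mate s)
                  (mate-differ (mates-unlike a s (met nu) (met nv)) a s)
  ... | false = subst (λ x → tot x u ≢ tot x v) (ec-cross s)
                  (cross-differ (nonroot-nonsplit nu) (nonroot-nonsplit nv) a s)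

  -- Repairs at one root, without and with a mate

  module AtRoot (r : Fin n) (r-root : root r ≡ r) where

    nbr-nonroot : ∀ {z} → adj G r z ≡ true → root z ≢ z
    nbr-nonroot a e = adj-irrefl G a (trans (≡-sym r-root) (trans (root-edge a) e))

    τ-root : τ r ≡ false
    τ-root = trans (cong (λ x → σ r xor σ x) r-root) (xor-same (σ r))

    Conflict : Bool → Fin n → Set
    Conflict flip z = adj G r z ≡ true × ρ (ec r z) r + ⟦ vc r xor flip == ec r z ⟧ ≡ tot (ec r z) z

    conflict? : ∀ flip → Dec (∃ (Conflict flip))
    conflict? flip = Fin.any? λ z →
      (adj G r z Bool.≟ true) ×-dec (ρ (ec r z) r + ⟦ vc r xor flip == ec r z ⟧ ℕ.≟ tot (ec r z) z)

    flip-repair : ∀ flip → ¬ ∃ (Conflict flip) → Repair r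
    flip-repair flip none = record
      { flip = flip
      ; S = λ _ → false
      ; S-nbr = λ ()
      ; differ = λ {z} a eq → none (z , a , subst (λ c → ρ c r + ⟦ vc r xor flip == c ⟧ ≡ tot c z)
          (xor-identityʳ (ec r z))
          (trans (cong (_+ ⟦ vc r xor flip == ec r z xor false ⟧)
            (nbrs-cong G {λ v w → ec v w == (ec r z xor false)} {λ v w → (ec v w xor false) == (ec r z xor false)} r
              (λ {w} _ → cong (_== (ec r z xor false)) (≡-sym (xor-identityʳ (ec r w)))))) eq))
      }

    no-repair : (∀ {z} → adj G r z ≡ true → tot (ec r z) r ≢ tot (ec r z) z) → Repair r
    no-repair ok = flip-repair false λ { (z , a , eq) →
      ok a (trans (cong (λ b → ρ (ec r z) r + ⟦ b == ec r z ⟧) (≡-sym (xor-identityʳ (vc r)))) eq) }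

    module Single (no-mate : mates r ≡ 0) where

      crossing : ∀ {z} → adj G r z ≡ true → same r z ≡ false
      crossing = nbrs≡0 G same no-mate

      module Halved (split : Split r) where

        ρ≡1 : ∀ c → ρ c r ≡ 1
        ρ≡1 true  = trans (ρ-single true no-mate) (proj₁ split)
        ρ≡1 false = trans (ρ-single false no-mate) (proj₁ (proj₂ split))

        -- The root has one red edge and an even target, so it is painted red.
        vc≡true : vc r ≡ true
        vc≡true = trans (cong (λ x → paint x (ρ true r) (ρ false r) (τ r)) (proj₁ split))
          (cong₂ (λ x t → odd x xor t) (ρ≡1 true) τ-root)

        degree≡2 : degree G r ≡ 2
        degree≡2 = trans (≡-sym (ρ-sum r)) (cong₂ _+_ (ρ≡1 true) (ρ≡1 false))

        nbr-odd : ∀ {z} → adj G r z ≡ true → odd (tot (ec r z) z) ≡ true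
        nbr-odd {z} a = trans (cong (λ c → odd (tot c z)) (ec-sym a))
          (trans (tot-parity (nonroot-nonsplit (nbr-nonroot a)) (adj-sym G a) (same-sym (crossing a)))
            (≢false (λ e → τ-cross a (crossing a) (trans τ-root (≡-sym e)))))
          where
          ≢false : ∀ {x} → x ≢ false → x ≡ true
          ≢false {true}  _  = refl
          ≢false {false} ne = ⊥-elim (ne refl)

        -- The root has total 2 in its own colour and 1 in the other, whereas its neighbours have
        -- odd totals. So only the edge unlike the root in colour can fail, and only against a total
        -- of 1.
        conflict : ∀ {flip z} → Conflict flip z → ec r z ≡ flip × tot (ec r z) z ≡ 1
        conflict {flip} {z} (a , eq) = low flip (ec r z) (nbr-odd a)
          (trans (cong₂ (λ x v → x + ⟦ v xor flip == ec r z ⟧) (≡-sym (ρ≡1 (ec r z))) (≡-sym vc≡true)) eq)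
          where
          low : ∀ f c {t} → odd t ≡ true → 1 + ⟦ true xor f == c ⟧ ≡ t → c ≡ f × t ≡ 1
          low true  true  _ refl = refl , refl
          low false false _ refl = refl , refl
          low true  false () refl
          low false true  () refl

        module Swap (conflicts : ∀ flip → ∃ (Conflict flip)) where

          -- The conflict for `flip = ec r z` occurs on an edge of that colour, and `r` has only one
          -- such edge.
          nbr-total : ∀ {z} → adj G r z ≡ true → tot (ec r z) z ≡ 1
          nbr-total {z} a with conflicts (ec r z)
          ... | y , conf with conflict {ec r z} conf
          ...   | col , one = subst (λ z → tot (ec r z) z ≡ 1) (≡-sym same-nbr) one
            where
            same-nbr : z ≡ y
            same-nbr = count≡1⇒unique (λ w → adj G r w ∧ (ec r w == ec r z)) (ρ≡1 (ec r z))
              (cong₂ _∧_ a (==-refl (ec r z)))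
              (cong₂ _∧_ (proj₁ conf) (trans (cong (_== ec r z) col) (==-refl (ec r z))))

          nbr-ρ : ∀ {z} → adj G r z ≡ true → 1 ≤ ρ (ec r z) z
          nbr-ρ {z} a = nbrs>0 G (λ v w → ec v w == ec r z) (adj-sym G a)
            (trans (cong (_== ec r z) (≡-sym (ec-sym a))) (==-refl (ec r z)))

          -- The edge to `r` already accounts for the whole total of 1, so `z` has the other colour.
          -- This is what `S-nbr` asks for.
          nbr-vc : ∀ {z} → adj G r z ≡ true → vc z ≡ not (ec r z)
          nbr-vc {z} a = other (vc z) (ec r z) (nbr-ρ a) (nbr-total a)
            where
            other : ∀ b c {x} → 1 ≤ x → x + ⟦ b == c ⟧ ≡ 1 → b ≡ not c
            other true  false _ _ = refl
            other false true  _ _ = refl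
            other true  true  {suc x} _ e rewrite +-comm x 1 with e
            ... | ()
            other false false {suc x} _ e rewrite +-comm x 1 with e
            ... | ()

          -- The root has priority 1, so `z` is cubic or has degree 2 without a mate. In the second
          -- case `single-even` gives both edges at `z` the same colour, and the total in the colour
          -- of `r z` would be at least 2.
          nbr-degree : ∀ {z} → adj G r z ≡ true → degree G z ≡ 3
          nbr-degree {z} a with priority≤1 {z} (≤-trans (root-max z)
            (≤-reflexive (trans (cong priority (trans (≡-sym (root-edge a)) r-root))
              (trans (cong₂ (λ x i → rank x i (degree G r))
                (nbrs-no-mate (λ v w → cubic v ∧ cubic w) no-mate) no-mate) (cong (rank 0 0) degree≡2)))))
          ... | inj₁ (_ , three) = three
          ... | inj₂ (m , two) = ⊥-elim (impossible (ec r z) (cross true z) (cross false z)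
                  (trans (≡-sym (trans (degree≡ z) (cong (_+_ (cross true z + cross false z)) m))) two)
                  (single-even m (met (nbr-nonroot a)))
                  (subst (1 ≤_) (trans (ρ-single _ m) (cross≡select (ec r z) z)) (nbr-ρ a))
                  (subst (_≤ 1) (trans (ρ-single _ m) (cross≡select (ec r z) z))
                    (≤-trans (m≤m+n (ρ (ec r z) z) _) (≤-reflexive (nbr-total a)))))
            where
            impossible : ∀ c x y → x + y + 0 ≡ 2 → odd x ≡ false → 1 ≤ select c x y → select c x y ≤ 1 → ⊥
            impossible true  1 _ _ () _ _
            impossible true  (suc (suc _)) _ _ _ _ (s≤s ())
            impossible false 1 1 _ () _ _
            impossible false 0 1 () _ _ _
            impossible false (suc (suc zero)) 1 () _ _ _
            impossible false (suc (suc (suc _))) 1 e _ _ _ with suc-injective (suc-injective e)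
            ... | ()
            impossible false _ (suc (suc _)) _ _ _ (s≤s ())

          nbr-other-total : ∀ {z} → adj G r z ≡ true → tot (not (ec r z)) z ≡ 3
          nbr-other-total {z} a = suc-injective (trans (cong (_+ tot (not (ec r z)) z) (≡-sym (nbr-total a)))
            (trans (tot-sum (ec r z) z) (cong (_+ 1) (nbr-degree a))))

          -- Both edges at `r` change colour together with their other ends. Each neighbour keeps
          -- its totals and is now compared in the colour where it has 3, while `r` still has one
          -- edge of each colour and so at most 2.
          swap-repair : Repair r
          swap-repair = record
            { flip   = false
            ; S      = adj G r
            ; S-nbr  = λ a → a , nbr-vc a
            ; differ = λ {z} a → differ a (trans (cong (ec r z xor_) a) (xor-comm (ec r z) true))
            }
            where
            differ : ∀ {z c} → adj G r z ≡ true → c ≡ not (ec r z) →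
              count (λ w → adj G r w ∧ ((ec r w xor adj G r w) == c)) + ⟦ vc r xor false == c ⟧ ≢ tot c z
            differ {z} a refl eq = 3≰2 (begin
              3                                     ≡⟨ nbr-other-total a ⟨
              tot (not (ec r z)) z                  ≡⟨ eq ⟨
              count (λ w → adj G r w ∧ ((ec r w xor adj G r w) == not (ec r z))) + ⟦ vc r xor false == not (ec r z) ⟧
                                                    ≡⟨ cong (_+ ⟦ vc r xor false == not (ec r z) ⟧) (nbrs-cong G
                                                        {λ v w → (ec v w xor adj G v w) == not (ec r z)} {λ v w → ec v w == ec r z} r
                                                        (λ {w} a′ → trans (cong (λ x → (ec r w xor x) == not (ec r z)) a′) (toggle (ec r w) (ec r z)))) ⟩
              ρ (ec r z) r + ⟦ vc r xor false == not (ec r z) ⟧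
                                                    ≤⟨ +-mono-≤ (≤-reflexive (ρ≡1 (ec r z))) (⟦⟧≤1 _) ⟩
              2                                     ∎)
              where
              open ≤-Reasoning
              3≰2 : ¬ 3 ≤ 2
              3≰2 (s≤s (s≤s ()))
              toggle : ∀ x y → (x xor true == not y) ≡ (x == y)
              toggle true  true  = refl
              toggle true  false = refl
              toggle false true  = refl
              toggle false false = refl

        halved-repair : Repair r
        halved-repair with conflict? false | conflict? true
        ... | no none | _       = flip-repair false none
        ... | yes _   | no none = flip-repair true none
        ... | yes f   | yes t   = Swap.swap-repair λ { true → t ; false → f }

      single-repair : Repair r
      single-repair with (cross true r ℕ.≟ 1) ×-dec (cross false r ℕ.≟ 1)
      ... | yes (red , blue) = Halved.halved-repair (red , blue , no-mate)
      ... | no ns = no-repair λ a → cross-differ (λ { (red , blue , _) → ns (red , blue) })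
                      (nonroot-nonsplit (nbr-nonroot a)) a (crossing a)

    module Mated (p : Fin n) (a : adj G r p ≡ true) (s : same r p ≡ true) where

      one-mate : mates r ≡ 1
      one-mate = mates≡1 a s

      mate-unique : ∀ {z} → adj G r z ≡ true → same r z ≡ true → z ≡ p
      mate-unique a′ s′ = count≡1⇒unique (λ w → adj G r w ∧ same r w) one-mate (cong₂ _∧_ a′ s′) (cong₂ _∧_ a s)

      UnlikeMate : Set
      UnlikeMate = Unlike (cross true r) (cross false r) (cross true p) (cross false p)

      unlike-repair : UnlikeMate → Repair r
      unlike-repair unlike = no-repair ok
        where
        ok : ∀ {z} → adj G r z ≡ true → tot (ec r z) r ≢ tot (ec r z) z
        ok {z} a′ = cases (same r z) refl
          where
          cases : ∀ x → same r z ≡ x → tot (ec r z) r ≢ tot (ec r z) z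
          cases true s′ with mate-unique a′ s′
          ... | refl = mate-differ unlike a s
          cases false s′ = cross-differ (λ { (_ , _ , m) → 1≢0 (trans (≡-sym one-mate) m) })
            (nonroot-nonsplit (nbr-nonroot a′)) a′ s′
            where
            1≢0 : 1 ≢ 0
            1≢0 ()

      -- Degree 3 on both ends: the root has priority 0, hence so has its whole component.
      cubic-unlike : degree G r ≡ 3 → degree G p ≡ 3 → UnlikeMate
      cubic-unlike dr dp = mates-unlike a s
        (Counting.root-met G σ root root-edge χ χ-sym r full met r-root) (met (nbr-nonroot a))
        where
        bottom : priority r ≤ 0
        bottom = rank-suc (nbrs>0 G (λ v w → same v w ∧ (cubic v ∧ cubic w)) a
          (cong₂ _∧_ s (cong₂ _∧_ (3⇒cubic dr) (3⇒cubic dp))))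
          where
          rank-suc : ∀ {x i d} → 1 ≤ x → rank x i d ≤ 0
          rank-suc (s≤s _) = z≤n
        full : ∀ v → root v ≡ r → inner G σ v ≡ 1 × outer G σ v ≡ 2
        full v e with priority≤0 {v} (≤-trans (root-max v) (subst (λ x → priority x ≤ 0) (≡-sym e) bottom))
        ... | m≢0 , three = one , +-cancelʳ-≡ 1 (outer G σ v) 2
                (trans (cong (outer G σ v +_) (≡-sym one)) (trans (≡-sym (degree≡outer v)) three))
          where
          one : mates v ≡ 1
          one = ≤-antisym (mates≤1 v) (n≢0⇒n>0 m≢0)

      -- Mates that are not `Unlike` have equally many crossing edges and equal red parity. With one
      -- edge each, these edges share a colour `c`; with two each, both mates are cubic.
      alike : ∀ {a b a′ b′} → Sides a b → Sides a′ b′ → ¬ Unlike a b a′ b′ →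
        (∃ λ c → (select c a b ≡ 1 × select (not c) a b ≡ 0) × (select c a′ b′ ≡ 1 × select (not c) a′ b′ ≡ 0)) ⊎
        (a + b ≡ 2 × a′ + b′ ≡ 2)
      alike R  R  _ = inj₁ (true , (refl , refl) , (refl , refl))
      alike B  B  _ = inj₁ (false , (refl , refl) , (refl , refl))
      alike R  B  nu = ⊥-elim (nu (inj₁ refl))
      alike B  R  nu = ⊥-elim (nu (inj₁ refl))
      alike R  RR nu = ⊥-elim (nu (inj₂ λ ()))
      alike R  RB nu = ⊥-elim (nu (inj₂ λ ()))
      alike R  BB nu = ⊥-elim (nu (inj₂ λ ()))
      alike B  RR nu = ⊥-elim (nu (inj₂ λ ()))
      alike B  RB nu = ⊥-elim (nu (inj₂ λ ()))
      alike B  BB nu = ⊥-elim (nu (inj₂ λ ()))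
      alike RR R  nu = ⊥-elim (nu (inj₂ λ ()))
      alike RB R  nu = ⊥-elim (nu (inj₂ λ ()))
      alike BB R  nu = ⊥-elim (nu (inj₂ λ ()))
      alike RR B  nu = ⊥-elim (nu (inj₂ λ ()))
      alike RB B  nu = ⊥-elim (nu (inj₂ λ ()))
      alike BB B  nu = ⊥-elim (nu (inj₂ λ ()))
      alike RR RR _ = inj₂ (refl , refl)
      alike RR RB _ = inj₂ (refl , refl)
      alike RR BB _ = inj₂ (refl , refl)
      alike RB RR _ = inj₂ (refl , refl)
      alike RB RB _ = inj₂ (refl , refl)
      alike RB BB _ = inj₂ (refl , refl)
      alike BB RR _ = inj₂ (refl , refl)
      alike BB RB _ = inj₂ (refl , refl)
      alike BB BB _ = inj₂ (refl , refl)

      Leaf : Bool → Fin n → Set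
      Leaf c v = select c (cross true v) (cross false v) ≡ 1 × select (not c) (cross true v) (cross false v) ≡ 0

      -- Both mates have degree 2, a crossing edge and vertex colour `c`, and between them an edge
      -- of the opposite colour. In that colour both totals are 1, so the edge between them fails.
      module Alike (c : Bool) (leaf-r : Leaf c r) (leaf-p : Leaf c p) where

        leaf-inner : ∀ c {τ a b a′ b′} → select c a b ≡ 1 × select (not c) a b ≡ 0 →
          select c a′ b′ ≡ 1 × select (not c) a′ b′ ≡ 0 → inner-colour τ a b a′ b′ ≡ not c
        leaf-inner true  (refl , refl) _ = refl
        leaf-inner false (refl , refl) (refl , refl) = refl

        leaf-paint : ∀ c {a b} → select c a b ≡ 1 × select (not c) a b ≡ 0 →
          paint a (a + ⟦ not c == true ⟧) (b + ⟦ not c == false ⟧) false ≡ c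
        leaf-paint true  (refl , refl) = refl
        leaf-paint false (refl , refl) = refl

        leaf-sum : ∀ c {a b} → select c a b ≡ 1 × select (not c) a b ≡ 0 → a + b ≡ 1
        leaf-sum true  (refl , refl) = refl
        leaf-sum false (refl , refl) = refl

        ==-not : ∀ c → ⟦ not c == c ⟧ ≡ 0
        ==-not true  = refl
        ==-not false = refl

        a-sym : adj G p r ≡ true
        a-sym = adj-sym G a
        s-sym : same p r ≡ true
        s-sym = same-sym s

        ec-rp : ec r p ≡ not c
        ec-rp = trans (ec-mate s) (leaf-inner c leaf-r leaf-p)

        ec-pr : ec p r ≡ not c
        ec-pr = trans (≡-sym (ec-sym a)) ec-rp

        τ-p : τ p ≡ false
        τ-p = trans (≡-sym (τ-mate a s)) τ-root

        leaf-vc : ∀ {v w} → adj G v w ≡ true → same v w ≡ true → ec v w ≡ not c → τ v ≡ false → Leaf c v → vc v ≡ c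
        leaf-vc {v} a s e t leaf = trans (vc-mate a s) (trans
          (cong₂ (λ x t → paint (cross true v) (cross true v + ⟦ x == true ⟧) (cross false v + ⟦ x == false ⟧) t) e t)
          (leaf-paint c leaf))

        leaf-ρ : ∀ {v w} → adj G v w ≡ true → same v w ≡ true → ec v w ≡ not c → Leaf c v →
                 ρ c v ≡ 1 × ρ (not c) v ≡ 1
        leaf-ρ {v} a s e (one , none) =
          trans (ρ-mate c a s) (cong₂ _+_ (trans (cross≡select c v) one) (trans (cong (λ x → ⟦ x == c ⟧) e) (==-not c))) ,
          trans (ρ-mate (not c) a s) (cong₂ _+_ (trans (cross≡select (not c) v) none)
            (trans (cong (λ x → ⟦ x == not c ⟧) e) (cong ⟦_⟧ (==-refl (not c)))))

        vc-r : vc r ≡ c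
        vc-r = leaf-vc a s ec-rp τ-root leaf-r

        vc-p : vc p ≡ c
        vc-p = leaf-vc a-sym s-sym ec-pr τ-p leaf-p

        ρ-r : ρ c r ≡ 1 × ρ (not c) r ≡ 1
        ρ-r = leaf-ρ a s ec-rp leaf-r

        ρ-p : ρ c p ≡ 1 × ρ (not c) p ≡ 1
        ρ-p = leaf-ρ a-sym s-sym ec-pr leaf-p

        tot-p : tot c p ≡ 2
        tot-p = cong₂ _+_ (proj₁ ρ-p) (trans (cong (λ x → ⟦ x == c ⟧) vc-p) (cong ⟦_⟧ (==-refl c)))

        tot-p-other : tot (not c) p ≡ 1
        tot-p-other = cong₂ _+_ (proj₂ ρ-p) (trans (cong (λ x → ⟦ x == not c ⟧) vc-p) (not-== c))
          where
          not-== : ∀ c → ⟦ c == not c ⟧ ≡ 0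
          not-== true  = refl
          not-== false = refl

        degree-r : degree G r ≡ 2
        degree-r = trans (degree≡ r) (cong₂ _+_ (leaf-sum c leaf-r) one-mate)

        nbr-colour : ∀ {z} → adj G r z ≡ true → (ec r z ≡ c) ⊎ (z ≡ p)
        nbr-colour {z} a′ with ec r z Bool.≟ c
        ... | yes e = inj₁ e
        ... | no ne = inj₂ (count≡1⇒unique (λ w → adj G r w ∧ (ec r w == not c)) (proj₂ ρ-r)
          (cong₂ _∧_ a′ (trans (cong (_== not c) (¬-not ne)) (==-refl (not c))))
          (cong₂ _∧_ a (trans (cong (_== not c) ec-rp) (==-refl (not c)))))

        -- Recolouring `r` raises its total in the colour of the mate edge to 2, against 1 at `p`.
        -- So only the crossing edge can still fail, and only when its other end has total 1 in
        -- colour `c`.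
        conflict : ∀ {z} → Conflict true z → ec r z ≡ c × tot c z ≡ 1
        conflict {z} (a′ , eq) with nbr-colour a′
        ... | inj₁ e = e , trans (≡-sym (subst (λ x → ρ x r + ⟦ vc r xor true == x ⟧ ≡ tot x z) e eq))
                (cong₂ _+_ (proj₁ ρ-r) (trans (cong (λ x → ⟦ x xor true == c ⟧) vc-r) (xor-== c)))
          where
          xor-== : ∀ c → ⟦ c xor true == c ⟧ ≡ 0
          xor-== true  = refl
          xor-== false = refl
        ... | inj₂ refl = ⊥-elim (2≢1 (trans
                (≡-sym (cong₂ _+_ (proj₂ ρ-r) (trans (cong (λ x → ⟦ x xor true == not c ⟧) vc-r) (xor-== c))))
                (trans (subst (λ x → ρ x r + ⟦ vc r xor true == x ⟧ ≡ tot x p) ec-rp eq) tot-p-other)))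
          where
          2≢1 : 2 ≢ 1
          2≢1 ()
          xor-== : ∀ c → ⟦ c xor true == not c ⟧ ≡ 1
          xor-== true  = refl
          xor-== false = refl

        -- Here the mate edge is recoloured together with `p`, whose totals stay. Now `r` and both
        -- its edges have colour `c`, giving total 3, against 2 at `p` and, by the conflict, 1 at
        -- the other neighbour.
        inner-repair : ∃ (Conflict true) → Repair r
        inner-repair (y , conf) = record
          { flip   = false
          ; S      = S
          ; S-nbr  = S-nbr
          ; differ = λ a′ → differ a′ (uniform a′)
          }
          where
          S : Fin n → Bool
          S z = adj G r z ∧ same r z
          S-nbr : ∀ {z} → S z ≡ true → adj G r z ≡ true × vc z ≡ not (ec r z)
          S-nbr {z} e with ∧-true {adj G r z} e
          ... | a′ , s′ with mate-unique a′ s′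
          ...   | refl = a , trans vc-p (trans (≡-sym (not-involutive c)) (cong not (≡-sym ec-rp)))
          uniform : ∀ {z} → adj G r z ≡ true → ec r z xor S z ≡ c
          uniform {z} a′ = cases (same r z) refl
            where
            cases : ∀ x → same r z ≡ x → ec r z xor S z ≡ c
            cases true s′ with mate-unique a′ s′
            ... | refl = trans (cong₂ _xor_ ec-rp (cong₂ _∧_ a s)) (trans (xor-comm (not c) true) (not-involutive c))
            cases false s′ with nbr-colour a′
            ... | inj₁ e    = trans (cong₂ _xor_ e (cong₂ _∧_ a′ s′)) (xor-identityʳ c)
            ... | inj₂ refl = true≢false s s′
          tot≤2 : ∀ {z} → adj G r z ≡ true → tot c z ≤ 2
          tot≤2 {z} a′ with nbr-colour a′
          ... | inj₂ refl = ≤-reflexive tot-p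
          ... | inj₁ e = ≤-trans (≤-reflexive (trans (cong (tot c) z≡y) (proj₂ (conflict conf)))) (s≤s z≤n)
            where
            z≡y : z ≡ y
            z≡y = count≡1⇒unique (λ w → adj G r w ∧ (ec r w == c)) (proj₁ ρ-r)
              (cong₂ _∧_ a′ (trans (cong (_== c) e) (==-refl c)))
              (cong₂ _∧_ (proj₁ conf) (trans (cong (_== c) (proj₁ (conflict conf))) (==-refl c)))
          differ : ∀ {z x} → adj G r z ≡ true → x ≡ c →
            count (λ w → adj G r w ∧ ((ec r w xor S w) == x)) + ⟦ vc r xor false == x ⟧ ≢ tot x z
          differ {z} a′ refl eq = 3≰2 (subst (_≤ 2) (trans (≡-sym eq) (cong₂ _+_ all-c vc-c)) (tot≤2 a′))
            where
            3≰2 : ¬ 3 ≤ 2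
            3≰2 (s≤s (s≤s ()))
            ∧-=> : ∀ {p q} → (p ≡ true → q ≡ true) → p ∧ q ≡ p
            ∧-=> {true}  f = f refl
            ∧-=> {false} f = refl
            all-c : count (λ w → adj G r w ∧ ((ec r w xor S w) == c)) ≡ 2
            all-c = trans (count-cong λ w → ∧-=> λ a″ → trans (cong (_== c) (uniform {w} a″)) (==-refl c)) degree-r
            vc-c : ⟦ vc r xor false == c ⟧ ≡ 1
            vc-c = cong ⟦_⟧ (trans (cong (_== c) (trans (xor-identityʳ (vc r)) vc-r)) (==-refl c))

        alike-repair : Repair r
        alike-repair with conflict? true
        ... | no none = flip-repair true none
        ... | yes conf = inner-repair conf

      mated-repair : Repair r
      mated-repair with odd (cross true r) xor odd (cross true p) Bool.≟ true
                      | cross true r + cross false r ℕ.≟ cross true p + cross false p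
      ... | yes u | _     = unlike-repair (inj₁ u)
      ... | no _  | no ne = unlike-repair (inj₂ ne)
      ... | no nu | yes e
        with alike (mate-sides r one-mate) (mate-sides p (mates≡1 (adj-sym G a) (same-sym s)))
               (λ { (inj₁ u) → nu u ; (inj₂ ne) → ne e })
      ...   | inj₁ (c , leaf-r , leaf-p) = Alike.alike-repair c leaf-r leaf-p
      ...   | inj₂ (dr , dp) = unlike-repair (cubic-unlike
                (trans (degree≡ r) (cong₂ _+_ dr one-mate))
                (trans (degree≡ p) (cong₂ _+_ dp (mates≡1 (adj-sym G a) (same-sym s)))))

    root-repair : Repair r
    root-repair = cases (mates r) refl
      where
      cases : ∀ i → mates r ≡ i → Repair r
      cases zero e = Single.single-repair e
      cases (suc i) e with count-witness (λ w → adj G r w ∧ same r w) (subst (1 ≤_) (≡-sym e) (s≤s z≤n))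
      ... | p , as with ∧-true {adj G r p} as
      ...   | a , s = Mated.mated-repair p a s

  solution : tlir≤ G 2
  solution = Apply.tlir nonroot-ok λ r e → AtRoot.root-repair r e

theorem2 : (n : ℕ) (G : SimpleGraph n) → Subcubic G → tlir≤ G 2
theorem2 n G subcubic with unfriendly-partition G
... | σ , unfriendly with spanning-forest G (Priority.priority G σ)
-- The demand is one at exactly one vertex of each pair of mates and zero elsewhere.
...   | F , root-edge with demand-join G (Forest.root-idem F) (Forest.path F)
                             (λ v → odd (nbrs G (λ v w → (σ v == σ w) ∧ before v w) v))
...     | χ , χ-sym , met =
  Solution.solution G subcubic σ unfriendly (Forest.root F) root-edge (Forest.root-max F) χ χ-sym met
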